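{- For any $n\ge 1$ and $k\ge 0$, the Tamari lattice $\operatorname{Tam}_n$ and the Dyck lattice $\operatorname{Dyck}_n$ have the same number of linear intervals of height $k$.
   Context: Intervals. In a finite poset, for $P\le Q$ the interval $[P,Q]$ is the set of $R$ with $P\le R\le Q$. Its height is the maximal length $k$ of a chain $P=P_0<P_1<\dots<P_k=Q$. It is linear if it is totally ordered. Tamari lattice. A tree is a planar rooted binary tree; its size is its number of (internal) nodes, each node having a left and a right son (each a node or a leaf). $\operatorname{Tam}_n$ is the set of trees of size $n$ ordered by the reflexive transitive closure of left rotations, where a left rotation at a node replaces, somewhere in the tree, a subtree of the form $(B,(C,D))$ by $((B,C),D)$ (here $(X,Y)$ denotes the tree whose root node has left subtree $X$ and right subtree $Y$, and $B,C,D$ are trees, possibly reduced to a leaf); the rotated tree is the larger one. Dyck lattice. A Dyck path of size $n$ is a word with $n$ letters $u$ (up steps) and $n$ letters $d$ (down steps) such that every prefix contains at least as many $u$ as $d$. The height of a step is the number of $u$ preceding it minus the number of $d$ preceding it. $\operatorname{Dyck}_n$ is the set of Dyck paths of size $n$ with $P\le Q$ if and only if for every $1\le k\le 2n$ the height of the $k$-th step of $P$ is at most that of the $k$-th step of $Q$. -}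

module Defs where

open import Data.Empty using (⊥-elim)
open import Data.Fin.Base using (Fin; toℕ; fromℕ<)
open import Data.Fin.Properties using (toℕ-fromℕ<)
open import Data.List.Base using (List; []; _∷_; length; take; filter; inits)
open import Data.List.Membership.Propositional using (_∈_)
open import Data.List.Membership.Propositional.Properties using (∈-map⁺)
open import Data.List.Relation.Unary.All using (All)
import Data.List.Relation.Unary.All as All
open import Data.List.Relation.Unary.Any using (here; there)
open import Data.List.Relation.Unary.Unique.Propositional using (Unique)
open import Data.Nat.Base using (ℕ; zero; suc; _+_; _*_; _∸_; _≤_; _<_; z≤n; s≤s)
import Data.Nat.Properties as ℕ
open import Data.Nat.Tactic.RingSolver using (solve-∀)
open import Data.Product.Base using (Σ; ∃; _×_; _,_; proj₁; proj₂)
open import Data.Sum.Base using (_⊎_)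
open import Function.Base using (_on_)
open import Function.Bundles using (_⇔_)
open import Level using (0ℓ)
open import Relation.Binary.Core using (Rel)
open import Relation.Binary.Construct.Closure.ReflexiveTransitive using (Star; ε; _◅_; _◅◅_)
import Relation.Binary.Construct.NonStrictToStrict as NonStrictToStrict
open import Relation.Binary.Definitions using (DecidableEquality)
open import Relation.Binary.PropositionalEquality
open import Relation.Binary.Structures using (IsPartialOrder)
open import Relation.Nullary using (yes; no)
open import Relation.Unary using (Pred)

-- P has exactly m elements.
HasCardinality : {A : Set} → Pred A 0ℓ → ℕ → Set
HasCardinality P m =
  ∃ λ xs → Unique xs × (∀ x → x ∈ xs ⇔ P x) × length xs ≡ m

module Intervals {A : Set} {_≼_ : Rel A 0ℓ} (po : IsPartialOrder _≡_ _≼_) where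

  open NonStrictToStrict _≡_ _≼_ using () renaming (_<_ to _≺_)

  _∈[_,_] : A → A → A → Set
  r ∈[ p , q ] = p ≼ r × r ≼ q

  data Chain : A → A → ℕ → Set where
    []  : ∀ {p} → Chain p p 0
    _∷_ : ∀ {p q r k} → p ≺ q → Chain q r k → Chain p r (suc k)

  HasHeight : A → A → ℕ → Set
  HasHeight p q k = Chain p q k × (∀ {j} → Chain p q j → j ≤ k)

  IsLinear : A → A → Set
  IsLinear p q =
    ∀ {r s} → r ∈[ p , q ] → s ∈[ p , q ] → r ≼ s ⊎ s ≼ r

  -- An interval is determined by its endpoints, so intervals are counted as
  -- pairs of endpoints.
  LinearIntervalOfHeight : ℕ → Pred (A × A) 0ℓ
  LinearIntervalOfHeight k (p , q) = p ≼ q × IsLinear p q × HasHeight p q k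

open Intervals public using (LinearIntervalOfHeight)

data Tree : Set where
  leaf : Tree
  node : Tree → Tree → Tree

size : Tree → ℕ
size leaf       = 0
size (node l r) = suc (size l + size r)

infix 4 _↷_ _≤Tree_ _≤Tam_ _≤Dyck_

-- s ↷ t : t is obtained from s by one left rotation somewhere in s.
data _↷_ : Rel Tree 0ℓ where
  rotate : ∀ {b c d} → node b (node c d) ↷ node (node b c) d
  left   : ∀ {l l′ r} → l ↷ l′ → node l r ↷ node l′ r
  right  : ∀ {l r r′} → r ↷ r′ → node l r ↷ node l r′

_≤Tree_ : Rel Tree 0ℓ
_≤Tree_ = Star _↷_

Tam : ℕ → Set
Tam n = Σ Tree λ t → size t ≡ n

-- Rotations preserve the size, so the closure may be taken on all trees.
_≤Tam_ : ∀ {n} → Rel (Tam n) 0ℓ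
_≤Tam_ = _≤Tree_ on proj₁

data Step : Set where
  u d : Step

_≟_ : DecidableEquality Step
u ≟ u = yes refl
u ≟ d = no λ ()
d ≟ u = no λ ()
d ≟ d = yes refl

# : Step → List Step → ℕ
# s w = length (filter (s ≟_) w)

record Dyck (n : ℕ) : Set where
  constructor dyck
  field
    word     : List Step
    #u≡n     : # u word ≡ n
    #d≡n     : # d word ≡ n
    prefixes : All (λ v → # d v ≤ # u v) (inits word)

open Dyck public

-- Height of the step of P preceded by exactly i steps.  The truncated
-- subtraction is exact, by the prefix condition.
stepHeight : ∀ {n} → Dyck n → ℕ → ℕ
stepHeight P i = # u (take i (word P)) ∸ # d (take i (word P))

_≤Dyck_ : ∀ {n} → Rel (Dyck n) 0ℓ
_≤Dyck_ {n} P Q = ∀ (i : Fin (2 * n)) → stepHeight P (toℕ i) ≤ stepHeight Q (toℕ i)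

-- Every left rotation strictly increases the sum, over all nodes, of the
-- sizes of the left subtrees.
weight : Tree → ℕ
weight leaf       = 0
weight (node l r) = size l + (weight l + weight r)

size-↷ : ∀ {s t} → s ↷ t → size s ≡ size t
size-↷ (rotate {b} {c} {e}) = lemma (size b) (size c) (size e)
  where
  lemma : ∀ x y z → suc (x + suc (y + z)) ≡ suc (suc (x + y) + z)
  lemma = solve-∀
size-↷ (left {r = r} p)  = cong (λ x → suc (x + size r)) (size-↷ p)
size-↷ (right {l = l} p) = cong (λ x → suc (size l + x)) (size-↷ p)

weight-↷ : ∀ {s t} → s ↷ t → weight s < weight t
weight-↷ (rotate {b} {c} {e}) =
  subst (suc X ≤_) (sym (lemma (size b) (size c) (weight b) (weight c) (weight e)))
    (s≤s (ℕ.m≤m+n X (size b)))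
  where
  X = size b + (weight b + (size c + (weight c + weight e)))
  lemma : ∀ x y p q r →
    suc (x + y) + ((x + (p + q)) + r) ≡ suc ((x + (p + (y + (q + r)))) + x)
  lemma = solve-∀
weight-↷ (left {l} {l′} {r} p) rewrite size-↷ p =
  ℕ.+-monoʳ-< (size l′) (ℕ.+-monoˡ-< (weight r) (weight-↷ p))
weight-↷ (right {l} p) =
  ℕ.+-monoʳ-< (size l) (ℕ.+-monoʳ-< (weight l) (weight-↷ p))

weight-≤ : ∀ {s t} → s ≤Tree t → weight s ≤ weight t
weight-≤ ε        = ℕ.≤-refl
weight-≤ (p ◅ ps) = ℕ.≤-trans (ℕ.<⇒≤ (weight-↷ p)) (weight-≤ ps)

≤Tree-antisym : ∀ {s t} → s ≤Tree t → t ≤Tree s → s ≡ t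
≤Tree-antisym ε        _  = refl
≤Tree-antisym (p ◅ ps) qs =
  ⊥-elim (ℕ.<-irrefl refl (ℕ.<-≤-trans (weight-↷ p) (weight-≤ (ps ◅◅ qs))))

Tam-≡ : ∀ {n} {s t : Tam n} → proj₁ s ≡ proj₁ t → s ≡ t
Tam-≡ {s = s , p} {t = .s , q} refl = cong (s ,_) (ℕ.≡-irrelevant p q)

Dyck-≡ : ∀ {n} {P Q : Dyck n} → word P ≡ word Q → P ≡ Q
Dyck-≡ {P = dyck w a b c} {Q = dyck .w a′ b′ c′} refl
  rewrite ℕ.≡-irrelevant a a′ | ℕ.≡-irrelevant b b′
        | All.irrelevant ℕ.≤-irrelevant c c′ = refl

take∈inits : ∀ i (w : List Step) → take i w ∈ inits w
take∈inits zero    w       = here refl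
take∈inits (suc i) []      = here refl
take∈inits (suc i) (x ∷ w) = there (lemma (take∈inits i w))
  where
  lemma : ∀ {v} → v ∈ inits w → (x ∷ v) ∈ _
  lemma (here refl) = here refl
  lemma (there p)   = there (∈-map⁺ (x ∷_) p)

∸-cross : ∀ {a b a′ b′} → b ≤ a → b′ ≤ a′ → a ∸ b ≡ a′ ∸ b′ → a + b′ ≡ a′ + b
∸-cross {a} {b} {a′} {b′} p q e = begin
  a + b′              ≡⟨ cong (_+ b′) (sym (ℕ.m∸n+n≡m p)) ⟩
  (a ∸ b + b) + b′    ≡⟨ cong (λ x → (x + b) + b′) e ⟩
  (a′ ∸ b′ + b) + b′  ≡⟨ lemma (a′ ∸ b′) b b′ ⟩
  (a′ ∸ b′ + b′) + b  ≡⟨ cong (_+ b) (ℕ.m∸n+n≡m q) ⟩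
  a′ + b              ∎
  where
  open ≡-Reasoning
  lemma : ∀ x y z → (x + y) + z ≡ (x + z) + y
  lemma = solve-∀

SameHeights : List Step → List Step → Set
SameHeights w v = ∀ i → i < # u w + # d w →
  # u (take i w) + # d (take i v) ≡ # u (take i v) + # d (take i w)

sameHeights⇒≡ : ∀ w v → # u w ≡ # u v → # d w ≡ # d v → SameHeights w v → w ≡ v
sameHeights⇒≡ []      []      _ _ _ = refl
sameHeights⇒≡ []      (u ∷ v) () _ _
sameHeights⇒≡ []      (d ∷ v) _ () _
sameHeights⇒≡ (u ∷ w) []      () _ _
sameHeights⇒≡ (d ∷ w) []      _ () _
sameHeights⇒≡ (u ∷ w) (u ∷ v) p q h =
  cong (u ∷_) (sameHeights⇒≡ w v (ℕ.suc-injective p) q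
    λ i i< → ℕ.suc-injective (h (suc i) (s≤s i<)))
sameHeights⇒≡ (d ∷ w) (d ∷ v) p q h =
  cong (d ∷_) (sameHeights⇒≡ w v p (ℕ.suc-injective q)
    λ i i< → ℕ.suc-injective
      (trans (sym (ℕ.+-suc (# u (take i w)) _))
        (trans (h (suc i) (subst (suc i <_) (sym (ℕ.+-suc (# u w) (# d w))) (s≤s i<)))
               (ℕ.+-suc (# u (take i v)) _))))
sameHeights⇒≡ (u ∷ w) (d ∷ v) p q h
  with () ← h 1 (s≤s (ℕ.≤-trans (subst (1 ≤_) (sym q) (s≤s z≤n)) (ℕ.m≤n+m _ (# u w))))
sameHeights⇒≡ (d ∷ w) (u ∷ v) p q h
  with () ← h 1 (ℕ.+-mono-≤ (subst (1 ≤_) (sym p) (s≤s z≤n)) (s≤s z≤n))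

≤Dyck-antisym : ∀ {n} {P Q : Dyck n} → P ≤Dyck Q → Q ≤Dyck P → P ≡ Q
≤Dyck-antisym {n} {P} {Q} P≤Q Q≤P = Dyck-≡
  (sameHeights⇒≡ (word P) (word Q)
    (trans (#u≡n P) (sym (#u≡n Q))) (trans (#d≡n P) (sym (#d≡n Q)))
    λ i i< → ∸-cross (prefix P i) (prefix Q i) (heights i (subst (i <_) total i<)))
  where
  prefix : ∀ (R : Dyck n) i → # d (take i (word R)) ≤ # u (take i (word R))
  prefix R i = All.lookup (prefixes R) (take∈inits i (word R))

  total : # u (word P) + # d (word P) ≡ 2 * n
  total = cong₂ _+_ (#u≡n P) (trans (#d≡n P) (sym (ℕ.+-identityʳ n)))

  heights : ∀ i → i < 2 * n → stepHeight P i ≡ stepHeight Q i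
  heights i i< = subst (λ j → stepHeight P j ≡ stepHeight Q j) (toℕ-fromℕ< i<)
    (ℕ.≤-antisym (P≤Q (fromℕ< i<)) (Q≤P (fromℕ< i<)))

Tam-isPartialOrder : ∀ n → IsPartialOrder _≡_ (_≤Tam_ {n})
Tam-isPartialOrder n = record
  { isPreorder = record
    { isEquivalence = isEquivalence
    ; reflexive     = λ { refl → ε }
    ; trans         = _◅◅_
    }
  ; antisym = λ p q → Tam-≡ (≤Tree-antisym p q)
  }

Dyck-isPartialOrder : ∀ n → IsPartialOrder _≡_ (_≤Dyck_ {n})
Dyck-isPartialOrder n = record
  { isPreorder = record
    { isEquivalence = isEquivalence
    ; reflexive     = λ { refl _ → ℕ.≤-refl }
    ; trans         = λ p q i → ℕ.≤-trans (p i) (q i)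
    }
  ; antisym = ≤Dyck-antisym
  }

{-# OPTIONS --safe #-}
module Submission where

-- In both lattices the linear intervals of height k are, apart from points,
-- of two kinds, which coincide for k = 1 and are disjoint for k at least 2.
--
-- Trees.  Inside some context, an interval of the first kind goes from a tree
-- (b , r) to the tree obtained by pushing b down k steps along the left spine
-- of r (Join, LeftI); the second kind is the mirror image (CoJoin, RightI),
-- the mirror symmetry being an antiautomorphism of the Tamari order.  Both the
-- linearity of these intervals and the fact that there are no others rest on
-- join-≤: the trees above (b , r) are the joins of some b' above b and some r'
-- above r.  Hence an interval above (b , r) combines three moves, one in b, one
-- in r and one along the left spine, and two independent moves would produce
-- two incomparable elements (classify, classify-mixed).
--
-- Words.  The Dyck lattice is an upper set in the dominance order on all words
-- (Dom), and P <= Q is linear only if the region between the two paths is a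
-- strip: some factor d u^k becomes u^k d (LeftW), or some factor d^k u becomes
-- u d^k (RightW); see classify-du.  Reflecting the paths in a vertical line
-- exchanges the two.
--
-- By the symmetries, both kinds are equinumerous in each lattice, so it remains
-- to compare the first kinds.  Encode the tree (l , r) by the Dyck word
-- u l d r.  The factors d u^k of the word of t correspond to the nodes of t
-- whose right son has a left spine of at least k nodes, so that as many intervals
-- of the first kind start at a tree as at its word (length-leftWords).  Summing over the trees of size n gives the claim.

open import Defs
open import Data.Empty using (⊥; ⊥-elim)
open import Data.Fin.Base using (toℕ; fromℕ<)
open import Data.Fin.Properties using (toℕ-fromℕ<)
open import Data.List.Base
  using (List; []; _∷_; _++_; _∷ʳ_; map; length; take; inits; filter; replicate; cartesianProductWith)
open import Data.List.Properties
  using (length-map; length-++; ++-assoc; ++-identityʳ; ∷-injectiveʳ; ≡-dec)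
open import Data.List.Membership.Propositional using (_∈_)
open import Data.List.Membership.Propositional.Properties
  using (∈-map⁺; ∈-map⁻; ∈-++⁺ˡ; ∈-++⁺ʳ; ∈-++⁻; ∈-filter⁺; ∈-filter⁻;
         ∈-cartesianProductWith⁺; ∈-cartesianProductWith⁻)
open import Data.List.Relation.Unary.All using (All; []; _∷_)
import Data.List.Relation.Unary.All as All
import Data.List.Relation.Unary.All.Properties as All
open import Data.List.Relation.Unary.AllPairs using ([]; _∷_)
open import Data.List.Relation.Unary.Any using (here; there)
open import Data.List.Relation.Unary.Unique.Propositional using (Unique)
import Data.List.Relation.Unary.Unique.Propositional.Properties as Unique
open import Data.Nat.Base using (ℕ; zero; suc; _+_; _*_; _∸_; _≤_; _<_; _≥_; z≤n; s≤s)
import Data.Nat.Properties as ℕ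
open import Data.Nat.Tactic.RingSolver using (solve-∀)
open import Data.Product.Base using (∃; ∃₂; _×_; _,_; proj₁; proj₂)
open import Data.Sum.Base using (_⊎_; inj₁; inj₂)
import Data.Sum.Base as Sum
open import Data.Vec.Base using (Vec; []; _∷_)
open import Function.Base using (_∘_; flip)
open import Function.Bundles using (_⇔_; mk⇔; Equivalence)
open import Level using (0ℓ)
open import Relation.Binary.Construct.Closure.ReflexiveTransitive using (ε; _◅_; _◅◅_; gmap)
open import Relation.Binary.Core using (Rel)
open import Relation.Binary.Definitions using (DecidableEquality)
open import Relation.Binary.PropositionalEquality
open import Relation.Binary.Structures using (IsPartialOrder)
open import Relation.Nullary using (¬_; yes; no)
open import Relation.Unary using (Pred)

open Equivalence using (to; from)

-- Enumeration of finite sets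

-- xs lists every element satisfying P exactly once.
Enumerates : {A : Set} → List A → Pred A 0ℓ → Set
Enumerates xs P = Unique xs × (∀ x → x ∈ xs ⇔ P x)

module _ {A : Set} where

  card-cong : {P Q : Pred A 0ℓ} {m : ℕ} → (∀ x → P x ⇔ Q x) → HasCardinality P m → HasCardinality Q m
  card-cong P⇔Q (xs , uniq , mem , len) = xs , uniq ,
    (λ x → mk⇔ (to (P⇔Q x) ∘ to (mem x)) (from (mem x) ∘ from (P⇔Q x))) , len

  card-⊎ : {P Q : Pred A 0ℓ} {m n : ℕ} → (∀ x → P x → Q x → ⊥) →
    HasCardinality P m → HasCardinality Q n → HasCardinality (λ x → P x ⊎ Q x) (m + n)
  card-⊎ disjoint (xs , uniq , mem , len) (ys , uniq′ , mem′ , len′) =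
    xs ++ ys ,
    Unique.++⁺ uniq uniq′ (λ (x∈xs , x∈ys) → disjoint _ (to (mem _) x∈xs) (to (mem′ _) x∈ys)) ,
    (λ x → mk⇔ (λ x∈ → split x (∈-++⁻ xs x∈))
      λ { (inj₁ p) → ∈-++⁺ˡ (from (mem x) p) ; (inj₂ q) → ∈-++⁺ʳ xs (from (mem′ x) q) }) ,
    trans (length-++ xs) (cong₂ _+_ len len′)
    where
    split : ∀ x → x ∈ xs ⊎ x ∈ ys → _
    split x (inj₁ i) = inj₁ (to (mem x) i)
    split x (inj₂ i) = inj₂ (to (mem′ x) i)

-- A predicate and its preimage under an injection hitting all of its elements
-- have the same cardinality.
card-pullback : {A B : Set} (f : A → B) {P : Pred B 0ℓ} {m : ℕ} →
  (∀ {x y} → f x ≡ f y → x ≡ y) → (∀ {y} → P y → ∃ λ x → f x ≡ y) →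
  HasCardinality P m → HasCardinality (P ∘ f) m
card-pullback f {P} inj hit (ys , uniq , mem , len) =
  let xs , eq = preimages ys (λ y y∈ → hit (to (mem y) y∈))
  in xs , Unique.map⁻ (subst Unique (sym eq) uniq)
   , (λ x → mk⇔ (λ x∈ → to (mem (f x)) (subst (f x ∈_) eq (∈-map⁺ f x∈)))
                (λ p → back (subst (f x ∈_) (sym eq) (from (mem (f x)) p))))
   , trans (sym (length-map f xs)) (trans (cong length eq) len)
  where
  preimages : ∀ ys → (∀ y → y ∈ ys → ∃ λ x → f x ≡ y) → ∃ λ xs → map f xs ≡ ys
  preimages []       _ = [] , refl
  preimages (y ∷ ys) h =
    let x , eq = h y (here refl)
        xs , eqs = preimages ys (λ z z∈ → h z (there z∈))
    in x ∷ xs , cong₂ _∷_ eq eqs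
  back : ∀ {x xs} → f x ∈ map f xs → x ∈ xs
  back {xs = xs} i = let x′ , x′∈ , eq = ∈-map⁻ f i in subst (_∈ xs) (sym (inj eq)) x′∈

module _ {A B : Set} (g : A → List B) where

  -- The pairs (x , y) with x in xs and y in g x.
  pairs : List A → List (A × B)
  pairs []       = []
  pairs (x ∷ xs) = map (x ,_) (g x) ++ pairs xs

  ∈-pairs⁻ : ∀ xs {x y} → (x , y) ∈ pairs xs → x ∈ xs × y ∈ g x
  ∈-pairs⁻ (x ∷ xs) i with ∈-++⁻ (map (x ,_) (g x)) i
  ... | inj₁ j with ∈-map⁻ (x ,_) j
  ...   | _ , y∈ , refl = here refl , y∈
  ∈-pairs⁻ (x ∷ xs) i | inj₂ j = let x∈ , y∈ = ∈-pairs⁻ xs j in there x∈ , y∈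

  ∈-pairs⁺ : ∀ {xs x y} → x ∈ xs → y ∈ g x → (x , y) ∈ pairs xs
  ∈-pairs⁺ (here refl) y∈ = ∈-++⁺ˡ (∈-map⁺ _ y∈)
  ∈-pairs⁺ (there x∈)  y∈ = ∈-++⁺ʳ _ (∈-pairs⁺ x∈ y∈)

  pairs-enumerates : ∀ {xs P} → (∀ x → Unique (g x)) → Enumerates xs P →
    Enumerates (pairs xs) (λ (x , y) → P x × y ∈ g x)
  pairs-enumerates {xs} uniq-g (uniq , mem) =
    unique xs uniq ,
    λ (x , y) → mk⇔ (λ i → let x∈ , y∈ = ∈-pairs⁻ xs i in to (mem x) x∈ , y∈)
                    (λ (p , y∈) → ∈-pairs⁺ (from (mem x) p) y∈)
    where
    unique : ∀ xs → Unique xs → Unique (pairs xs)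
    unique []       []         = []
    unique (x ∷ xs) (x∉ ∷ uxs) =
      Unique.++⁺ (Unique.map⁺ (λ { refl → refl }) (uniq-g x)) (unique xs uxs) disjoint
      where
      disjoint : ∀ {z} → ¬ (z ∈ map (x ,_) (g x) × z ∈ pairs xs)
      disjoint (i , j) with ∈-map⁻ (x ,_) i
      ... | _ , _ , refl = All.lookup x∉ (proj₁ (∈-pairs⁻ xs j)) refl

length-pairs : {A A′ B B′ : Set} (g : A → List B) (g′ : A′ → List B′) (f : A → A′) →
  (∀ x → length (g′ (f x)) ≡ length (g x)) →
  ∀ xs → length (pairs g′ (map f xs)) ≡ length (pairs g xs)
length-pairs g g′ f eq []       = refl
length-pairs g g′ f eq (x ∷ xs) = begin
  length (map (f x ,_) (g′ (f x)) ++ pairs g′ (map f xs))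
    ≡⟨ length-++ (map (f x ,_) (g′ (f x))) ⟩
  length (map (f x ,_) (g′ (f x))) + length (pairs g′ (map f xs))
    ≡⟨ cong₂ _+_ (trans (length-map _ (g′ (f x))) (trans (eq x) (sym (length-map _ (g x)))))
                 (length-pairs g g′ f eq xs) ⟩
  length (map (x ,_) (g x)) + length (pairs g xs)
    ≡⟨ length-++ (map (x ,_) (g x)) ⟨
  length (map (x ,_) (g x) ++ pairs g xs) ∎
  where open ≡-Reasoning

-- Linear intervals in partial orders

module _ {A : Set} {_≼_ : Rel A 0ℓ} (po : IsPartialOrder _≡_ _≼_) where

  open Intervals po hiding (LinearIntervalOfHeight)
  private module P = IsPartialOrder po

  chain⇒≼ : ∀ {p q k} → Chain p q k → p ≼ q
  chain⇒≼ []               = P.refl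
  chain⇒≼ ((p≼q , _) ∷ ch) = P.trans p≼q (chain⇒≼ ch)

  ¬chain-loop : ∀ {p k} → ¬ Chain p p (suc k)
  ¬chain-loop ((p≼r , p≢r) ∷ ch) = p≢r (P.antisym p≼r (chain⇒≼ ch))

  height-unique : ∀ {p q i j} → HasHeight p q i → HasHeight p q j → i ≡ j
  height-unique (ch , max) (ch′ , max′) = ℕ.≤-antisym (max′ ch) (max ch′)

  -- An interval is linear of height k as soon as its elements can be ranked
  -- so that the order follows the rank, every rank up to k is inhabited, and
  -- the endpoints have rank 0 and k.
  ranked⇒linear : ∀ {p q k} (E : ℕ → Pred A 0ℓ) → E 0 p → E k q →
    (∀ {r} → r ∈[ p , q ] → ∃ λ i → E i r) →
    (∀ {i j r s} → i ≤ j → E i r → E j s → r ≼ s) →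
    (∀ {i j r} → E i r → E j r → i ≡ j) →
    (∀ {i} → i ≤ k → ∃ (E i)) →
    LinearIntervalOfHeight po k (p , q)
  ranked⇒linear {p} {q} {k} E Ep Eq rank mono rank-unique inhabited =
    mono z≤n Ep Eq , linear , climb k Ep refl , bound Ep P.refl
    where
    linear : IsLinear p q
    linear r∈ s∈ with rank r∈ | rank s∈
    ... | i , Er | j , Es with ℕ.≤-total i j
    ...   | inj₁ i≤j = inj₁ (mono i≤j Er Es)
    ...   | inj₂ j≤i = inj₂ (mono j≤i Es Er)

    climb : ∀ j {i r} → E i r → i + j ≡ k → Chain r q j
    climb zero {i} Er i+0≡k with trans (sym (ℕ.+-identityʳ i)) i+0≡k
    ... | refl with P.antisym (mono ℕ.≤-refl Er Eq) (mono ℕ.≤-refl Eq Er)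
    ...   | refl = []
    climb (suc j) {i} Er i+j≡k =
      let 1+i+j≡k = trans (sym (ℕ.+-suc i j)) i+j≡k
          s , Es  = inhabited (subst (suc i ≤_) 1+i+j≡k (s≤s (ℕ.m≤m+n i j)))
      in (mono (ℕ.n≤1+n i) Er Es , λ { refl → ℕ.1+n≢n (rank-unique Es Er) }) ∷ climb j Es 1+i+j≡k

    bound : ∀ {i j r} → E i r → p ≼ r → Chain r q j → i + j ≤ k
    bound {i} Er _ [] = ℕ.≤-reflexive (trans (ℕ.+-identityʳ i) (rank-unique Er Eq))
    bound {i} {suc j} Er p≼r ((r≼s , r≢s) ∷ ch)
      with rank (P.trans p≼r r≼s , chain⇒≼ ch)
    ... | i′ , Es with ℕ.≤-<-connex i′ i
    ...   | inj₁ i′≤i = ⊥-elim (r≢s (P.antisym r≼s (mono i′≤i Es Er)))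
    ...   | inj₂ i<i′ = ℕ.≤-trans (subst (_≤ i′ + j) (sym (ℕ.+-suc i j)) (ℕ.+-monoˡ-≤ j i<i′))
                                  (bound Es (P.trans p≼r r≼s) ch)

  height-zero⇔ : ∀ {p q} → LinearIntervalOfHeight po 0 (p , q) ⇔ p ≡ q
  height-zero⇔ {p} = mk⇔ (λ { (_ , _ , [] , _) → refl }) λ { refl → point }
    where
    point : LinearIntervalOfHeight po 0 (p , p)
    point = ranked⇒linear (λ i r → i ≡ 0 × r ≡ p) (refl , refl) (refl , refl)
      (λ (p≼r , r≼p) → 0 , refl , P.antisym r≼p p≼r)
      (λ { _ (_ , refl) (_ , refl) → P.refl })
      (λ { (refl , _) (refl , _) → refl })
      (λ { z≤n → p , refl , refl })

  linear-sub : ∀ {p p′ q′ q} → p ≼ p′ → q′ ≼ q → IsLinear p q → IsLinear p′ q′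
  linear-sub p≼p′ q′≼q lin (a , b) (c , e) =
    lin (P.trans p≼p′ a , P.trans b q′≼q) (P.trans p≼p′ c , P.trans e q′≼q)

  not-linear : ∀ {p q r s} → IsLinear p q → r ∈[ p , q ] → s ∈[ p , q ] →
    ¬ (r ≼ s) → ¬ (s ≼ r) → ⊥
  not-linear lin r∈ s∈ r⋠s s⋠r with lin r∈ s∈
  ... | inj₁ r≼s = r⋠s r≼s
  ... | inj₂ s≼r = s⋠r s≼r

  flip-isPartialOrder : IsPartialOrder _≡_ (flip _≼_)
  flip-isPartialOrder = record
    { isPreorder = record
      { isEquivalence = isEquivalence
      ; reflexive     = λ { refl → P.refl }
      ; trans         = flip P.trans
      }
    ; antisym = flip P.antisym
    }

module _ {A : Set} {_≼_ : Rel A 0ℓ} (po : IsPartialOrder _≡_ _≼_) where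

  private
    module P = IsPartialOrder po
    module I = Intervals po
    module Iᵒ = Intervals (flip-isPartialOrder po)

  -- The dual order has the same linear intervals, with their ends exchanged.
  flip-interval : ∀ {k p q} → LinearIntervalOfHeight po k (p , q) →
    LinearIntervalOfHeight (flip-isPartialOrder po) k (q , p)
  flip-interval (p≼q , lin , ch , max) =
    p≼q , (λ (a , b) (c , e) → lin (b , a) (e , c) ↔) , rev ch , λ ch′ → max (revᵒ ch′)
    where
    _↔ : ∀ {r s} → r ≼ s ⊎ s ≼ r → s ≼ r ⊎ r ≼ s
    inj₁ x ↔ = inj₂ x
    inj₂ x ↔ = inj₁ x
    snoc : ∀ {p q r k} → Iᵒ.Chain p q k → r ≼ q → r ≢ q → Iᵒ.Chain p r (suc k)
    snoc Iᵒ.[]       r≼q r≢q = (r≼q , r≢q ∘ sym) Iᵒ.∷ Iᵒ.[]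
    snoc (x Iᵒ.∷ ch) r≼q r≢q = x Iᵒ.∷ snoc ch r≼q r≢q
    snocᵒ : ∀ {p q r k} → I.Chain p q k → q ≼ r → q ≢ r → I.Chain p r (suc k)
    snocᵒ I.[]       q≼r q≢r = (q≼r , q≢r) I.∷ I.[]
    snocᵒ (x I.∷ ch) q≼r q≢r = x I.∷ snocᵒ ch q≼r q≢r
    rev : ∀ {p q k} → I.Chain p q k → Iᵒ.Chain q p k
    rev I.[]                   = Iᵒ.[]
    rev ((p≼r , p≢r) I.∷ ch)   = snoc (rev ch) p≼r p≢r
    revᵒ : ∀ {p q k} → Iᵒ.Chain p q k → I.Chain q p k
    revᵒ Iᵒ.[]                 = I.[]
    revᵒ ((r≼p , p≢r) Iᵒ.∷ ch) = snocᵒ (revᵒ ch) r≼p (p≢r ∘ sym)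

-- f embeds A into B as an order-convex subset.
record ConvexEmbedding {A B : Set} (_≼_ : Rel A 0ℓ) (_⊴_ : Rel B 0ℓ) (f : A → B) : Set where
  field
    mono    : ∀ {p q} → p ≼ q → f p ⊴ f q
    reflect : ∀ {p q} → f p ⊴ f q → p ≼ q
    convex  : ∀ {p q r} → f p ⊴ r → r ⊴ f q → ∃ λ r₀ → f r₀ ≡ r

module _ {A B : Set} {_≼_ : Rel A 0ℓ} {_⊴_ : Rel B 0ℓ}
         (poA : IsPartialOrder _≡_ _≼_) (poB : IsPartialOrder _≡_ _⊴_)
         {f : A → B} (emb : ConvexEmbedding _≼_ _⊴_ f) where

  open ConvexEmbedding emb
  private
    module A = IsPartialOrder poA
    module B = IsPartialOrder poB
    module IA = Intervals poA
    module IB = Intervals poB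

    injective : ∀ {p q} → f p ≡ f q → p ≡ q
    injective eq = A.antisym (reflect (B.reflexive eq)) (reflect (B.reflexive (sym eq)))

    chain⁺ : ∀ {p q k} → IA.Chain p q k → IB.Chain (f p) (f q) k
    chain⁺ IA.[]                  = IB.[]
    chain⁺ ((p≼r , p≢r) IA.∷ ch) = (mono p≼r , p≢r ∘ injective) IB.∷ chain⁺ ch

    chain⁻ : ∀ {p q p′ q′ k} → f p ≡ p′ → f q ≡ q′ → IB.Chain p′ q′ k → IA.Chain p q k
    chain⁻ eq eq′ IB.[] with injective (trans eq (sym eq′))
    ... | refl = IA.[]
    chain⁻ refl refl ((p⊴r , p≢r) IB.∷ ch) with convex p⊴r (chain⇒≼ poB ch)
    ... | _ , refl = (reflect p⊴r , λ { refl → p≢r refl }) IA.∷ chain⁻ refl refl ch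

  linear-reflect : ∀ {p q} → IB.IsLinear (f p) (f q) → IA.IsLinear p q
  linear-reflect lin (a , b) (c , e) with lin (mono a , mono b) (mono c , mono e)
  ... | inj₁ x = inj₁ (reflect x)
  ... | inj₂ x = inj₂ (reflect x)

  embedding⇔ : ∀ {k p q} →
    LinearIntervalOfHeight poA k (p , q) ⇔ LinearIntervalOfHeight poB k (f p , f q)
  embedding⇔ {p = p} {q} = mk⇔
    (λ (p≼q , lin , ch , max) → mono p≼q , linear⁺ lin , chain⁺ ch , max ∘ chain⁻ refl refl)
    (λ (p⊴q , lin , ch , max) →
      reflect p⊴q , linear-reflect lin , chain⁻ refl refl ch , max ∘ chain⁺)
    where
    linear⁺ : IA.IsLinear p q → IB.IsLinear (f p) (f q)
    linear⁺ lin (a , b) (c , e) with convex a b | convex c e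
    ... | _ , refl | _ , refl with lin (reflect a , reflect b) (reflect c , reflect e)
    ...   | inj₁ x = inj₁ (mono x)
    ...   | inj₂ x = inj₂ (mono x)

-- The linear intervals other than points fall into two families L and R, indexed
-- by the height.  L contains all of those of height 1, and the families are
-- disjoint in larger heights.
record Classification {A : Set} {_≼_ : Rel A 0ℓ} (po : IsPartialOrder _≡_ _≼_) : Set₁ where
  open Intervals po using (IsLinear)
  field
    L R      : ℕ → A → A → Set
    L-sound  : ∀ {k p q} → L k p q → LinearIntervalOfHeight po k (p , q)
    R-sound  : ∀ {k p q} → R k p q → LinearIntervalOfHeight po k (p , q)
    disjoint : ∀ {k p q} → L (2 + k) p q → R (2 + k) p q → ⊥
    complete : ∀ {p q} → p ≼ q → IsLinear p q →
      p ≡ q ⊎ (∃ λ k → L (suc k) p q) ⊎ (∃ λ k → R (2 + k) p q)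

-- The pairs related by M whose first component satisfies S.
Among : {A : Set} → Pred A 0ℓ → Rel A 0ℓ → Pred (A × A) 0ℓ
Among S M (p , q) = S p × M p q

-- The number of linear intervals of height k, where c is the number of points
-- and l k the number of intervals of height suc k in each of the two families.
intervalCount : ℕ → (ℕ → ℕ) → ℕ → ℕ
intervalCount c l 0             = c
intervalCount c l 1             = l 0
intervalCount c l (suc (suc k)) = l (suc k) + l (suc k)

module _ {A : Set} {_≼_ : Rel A 0ℓ} {po : IsPartialOrder _≡_ _≼_} (cl : Classification po)
         (S : Pred A 0ℓ) where

  open Classification cl

  card-linear : ∀ {c l} → HasCardinality S c →
    (∀ k → HasCardinality (Among S (L (suc k))) (l k)) →
    (∀ k → HasCardinality (Among S (R (suc k))) (l k)) →
    ∀ k → HasCardinality (Among S (λ p q → LinearIntervalOfHeight po k (p , q))) (intervalCount c l k)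
  card-linear {c} cardS cardL cardR zero =
    card-cong (λ (p , q) → mk⇔
                (λ { (Sp , p≡q) → Sp , from (height-zero⇔ po) p≡q })
                (λ { (Sp , lin) → Sp , to (height-zero⇔ po) lin }))
      (diagonal cardS)
    where
    diagonal : HasCardinality S c → HasCardinality (Among S _≡_) c
    diagonal (xs , uniq , mem , len) =
      map (λ x → x , x) xs ,
      Unique.map⁺ (λ { refl → refl }) uniq ,
      (λ (p , q) → mk⇔ (λ i → diag i) λ { (Sp , refl) → ∈-map⁺ _ (from (mem p) Sp) }) ,
      trans (length-map _ xs) len
      where
      diag : ∀ {p q} → (p , q) ∈ map (λ x → x , x) xs → S p × p ≡ q
      diag i with ∈-map⁻ _ i
      ... | x , x∈ , refl = to (mem x) x∈ , refl
  card-linear _ cardL _ (suc zero) =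
    card-cong (λ (p , q) → mk⇔ (λ (Sp , l) → Sp , L-sound l) λ (Sp , lin) → Sp , classify lin) (cardL 0)
    where
    classify : ∀ {p q} → LinearIntervalOfHeight po 1 (p , q) → L 1 p q
    classify (p≼q , lin , h) with complete p≼q lin
    ... | inj₁ refl = ⊥-elim (¬chain-loop po (proj₁ h))
    ... | inj₂ (inj₁ (k , l)) with height-unique po h (proj₂ (proj₂ (L-sound l)))
    ...   | refl = l
    classify (p≼q , lin , h) | inj₂ (inj₂ (k , r))
      with () ← height-unique po h (proj₂ (proj₂ (R-sound r)))
  card-linear _ cardL cardR (suc (suc k)) =
    card-cong (λ (p , q) → mk⇔
        (λ { (inj₁ (Sp , l)) → Sp , L-sound l ; (inj₂ (Sp , r)) → Sp , R-sound r })
        λ (Sp , lin) → classify Sp lin)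
      (card-⊎ (λ _ (_ , l) (_ , r) → disjoint l r) (cardL (suc k)) (cardR (suc k)))
    where
    classify : ∀ {p q} → S p → LinearIntervalOfHeight po (2 + k) (p , q) →
      (S p × L (2 + k) p q) ⊎ (S p × R (2 + k) p q)
    classify Sp (p≼q , lin , h) with complete p≼q lin
    ... | inj₁ refl = ⊥-elim (¬chain-loop po (proj₁ h))
    ... | inj₂ (inj₁ (k , l)) with height-unique po h (proj₂ (proj₂ (L-sound l)))
    ...   | refl = inj₁ (Sp , l)
    classify Sp (p≼q , lin , h) | inj₂ (inj₂ (k , r)) with height-unique po h (proj₂ (proj₂ (R-sound r)))
    ...   | refl = inj₂ (Sp , r)

module _ {A B : Set} {_≼_ : Rel A 0ℓ} {_⊴_ : Rel B 0ℓ}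
         (poA : IsPartialOrder _≡_ _≼_) (poB : IsPartialOrder _≡_ _⊴_)
         {f : A → B} (emb : ConvexEmbedding _≼_ _⊴_ f) where

  -- If f embeds A as an upward closed subset S of B, then the linear intervals
  -- of A are those of B with lower end in S.
  card-embedding : {S : Pred B 0ℓ} → (∀ x → S (f x)) → (∀ {y} → S y → ∃ λ x → f x ≡ y) →
    (∀ {p q} → S p → p ⊴ q → S q) → ∀ {k m} →
    HasCardinality (Among S (λ p q → LinearIntervalOfHeight poB k (p , q))) m →
    HasCardinality (LinearIntervalOfHeight poA k) m
  card-embedding inS onto upward card = card-cong
    (λ (p , q) → mk⇔ (from (embedding⇔ poA poB emb) ∘ proj₂)
                     (λ lin → inS p , to (embedding⇔ poA poB emb) lin))
    (card-pullback (λ (p , q) → f p , f q)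
      (λ eq → cong₂ _,_ (injective (cong proj₁ eq)) (injective (cong proj₂ eq)))
      (λ (Sp , p⊴q , _) → lift (onto Sp) (onto (upward Sp p⊴q)))
      card)
    where
    open ConvexEmbedding emb
    injective : ∀ {p q} → f p ≡ f q → p ≡ q
    injective eq = IsPartialOrder.antisym poA
      (reflect (IsPartialOrder.reflexive poB eq)) (reflect (IsPartialOrder.reflexive poB (sym eq)))
    lift : ∀ {p q} → (∃ λ x → f x ≡ p) → (∃ λ y → f y ≡ q) → ∃ λ (x , y) → (f x , f y) ≡ (p , q)
    lift (x , refl) (y , refl) = (x , y) , refl

-- The Tamari order on trees

≤Tree-isPartialOrder : IsPartialOrder _≡_ _≤Tree_
≤Tree-isPartialOrder = record
  { isPreorder = record
    { isEquivalence = isEquivalence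
    ; reflexive     = λ { refl → ε }
    ; trans         = _◅◅_
    }
  ; antisym = ≤Tree-antisym
  }

size-≤ : ∀ {s t} → s ≤Tree t → size s ≡ size t
size-≤ ε        = refl
size-≤ (p ◅ ps) = trans (size-↷ p) (size-≤ ps)

node-mono : ∀ {l l′ r r′} → l ≤Tree l′ → r ≤Tree r′ → node l r ≤Tree node l′ r′
node-mono l≤l′ r≤r′ = gmap (λ t → node t _) left l≤l′ ◅◅ gmap (node _) right r≤r′

_≟Tree_ : DecidableEquality Tree
leaf     ≟Tree leaf       = yes refl
leaf     ≟Tree node _ _   = no λ ()
node _ _ ≟Tree leaf       = no λ ()
node l r ≟Tree node l′ r′ with l ≟Tree l′ | r ≟Tree r′
... | yes refl | yes refl = yes refl
... | no l≢l′  | _        = no λ { refl → l≢l′ refl }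
... | yes _    | no r≢r′  = no λ { refl → r≢r′ refl }

-- Join k b r t : t is obtained from node b r by pushing b down k steps along
-- the left spine of r.
data Join : ℕ → Tree → Tree → Tree → Set where
  here  : ∀ {b r} → Join 0 b r (node b r)
  there : ∀ {k b c e t} → Join k b c t → Join (suc k) b (node c e) (node t e)

join⇒≤ : ∀ {k b r t} → Join k b r t → node b r ≤Tree t
join⇒≤ here      = ε
join⇒≤ (there j) = rotate ◅ node-mono (join⇒≤ j) ε

join-size : ∀ {k b r t} → Join k b r t → size b < size t
join-size here              = s≤s (ℕ.m≤m+n _ _)
join-size (there {t = t} j) = ℕ.<-trans (join-size j) (s≤s (ℕ.m≤m+n (size t) _))

-- The size of b locates its position on the left spine of t.
join-unique : ∀ {k k′ b b′ r r′ t} → Join k b r t → Join k′ b′ r′ t → size b ≡ size b′ →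
  k ≡ k′ × b ≡ b′ × r ≡ r′
join-unique here      here       _  = refl , refl , refl
join-unique here      (there j′) eq = ⊥-elim (ℕ.<-irrefl (sym eq) (join-size j′))
join-unique (there j) here       eq = ⊥-elim (ℕ.<-irrefl eq (join-size j))
join-unique (there j) (there j′) eq with join-unique j j′ eq
... | refl , refl , refl = refl , refl , refl

-- The trees above a join of b and r, in particular above node b r itself, are
-- joins of trees above b and r.
join-≤ : ∀ {k b r t t′} → Join k b r t → t ≤Tree t′ →
  ∃ λ k′ → ∃₂ λ b′ r′ → b ≤Tree b′ × r ≤Tree r′ × Join k′ b′ r′ t′
join-≤ j ε        = _ , _ , _ , ε , ε , j
join-≤ j (p ◅ ps) =
  let _ , _ , _ , b≤ , r≤ , j₁ = step j p
      _ , _ , _ , b≤′ , r≤′ , j₂ = join-≤ j₁ ps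
  in _ , _ , _ , b≤ ◅◅ b≤′ , r≤ ◅◅ r≤′ , j₂
  where
  step : ∀ {k b r t t′} → Join k b r t → t ↷ t′ →
    ∃ λ k′ → ∃₂ λ b′ r′ → b ≤Tree b′ × r ≤Tree r′ × Join k′ b′ r′ t′
  step here      rotate    = _ , _ , _ , ε , ε , there here
  step here      (left p)  = _ , _ , _ , p ◅ ε , ε , here
  step here      (right p) = _ , _ , _ , ε , p ◅ ε , here
  step (there j) rotate    = _ , _ , _ , ε , rotate ◅ ε , there (there j)
  step (there j) (right p) = _ , _ , _ , ε , right p ◅ ε , there j
  step (there j) (left p)  =
    let _ , _ , _ , b≤ , r≤ , j′ = step j p
    in _ , _ , _ , b≤ , node-mono r≤ ε , there j′

-- The order between joins of trees with the same left size is that of the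
-- joined trees.
join-reflect : ∀ {k k′ b b′ r r′ t t′} → Join k b r t → Join k′ b′ r′ t′ →
  size b ≡ size b′ → t ≤Tree t′ → b ≤Tree b′ × r ≤Tree r′
join-reflect j j′ eq t≤t′ with join-≤ j t≤t′
... | _ , _ , _ , b≤ , r≤ , j″ with join-unique j″ j′ (trans (sym (size-≤ b≤)) eq)
...   | _ , refl , refl = b≤ , r≤

left-size : ∀ {l l′ r r′} → node l r ≤Tree node l′ r′ → size l ≤ size l′
left-size le with join-≤ here le
... | _ , _ , _ , l≤ , _ , here    = ℕ.≤-reflexive (size-≤ l≤)
... | _ , _ , _ , l≤ , _ , there j = ℕ.≤-trans (ℕ.≤-reflexive (size-≤ l≤)) (ℕ.<⇒≤ (join-size j))

between-nodes : ∀ {l l′ r r′ t} → size l ≡ size l′ → node l r ≤Tree t → t ≤Tree node l′ r′ →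
  ∃₂ λ l₀ r₀ → t ≡ node l₀ r₀ × (l ≤Tree l₀ × r ≤Tree r₀) × (l₀ ≤Tree l′ × r₀ ≤Tree r′)
between-nodes {t = leaf} _ le _ with () ← size-≤ le
between-nodes {t = node l₀ r₀} eq le le′ =
  let eq₀ = ℕ.≤-antisym (left-size le) (ℕ.≤-trans (left-size le′) (ℕ.≤-reflexive (sym eq)))
  in l₀ , r₀ , refl , join-reflect here here eq₀ le
   , join-reflect here here (trans (sym eq₀) eq) le′

node-embeddingˡ : ∀ {r} → ConvexEmbedding _≤Tree_ _≤Tree_ (λ l → node l r)
node-embeddingˡ {r} = record
  { mono    = λ le → node-mono le ε
  ; reflect = reflect
  ; convex  = convex
  }
  where
  reflect : ∀ {l l′} → node l r ≤Tree node l′ r → l ≤Tree l′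
  reflect {l} {l′} le = proj₁ (join-reflect here here
    (ℕ.+-cancelʳ-≡ (size r) (size l) (size l′) (ℕ.suc-injective (size-≤ le))) le)
  convex : ∀ {l l′ t} → node l r ≤Tree t → t ≤Tree node l′ r → ∃ λ l₀ → node l₀ r ≡ t
  convex le le′ with between-nodes (size-≤ (reflect (le ◅◅ le′))) le le′
  ... | l₀ , _ , refl , (_ , r≤) , (_ , ≤r) = l₀ , cong (node l₀) (≤Tree-antisym r≤ ≤r)

node-embeddingʳ : ∀ {l} → ConvexEmbedding _≤Tree_ _≤Tree_ (node l)
node-embeddingʳ {l} = record
  { mono    = node-mono ε
  ; reflect = proj₂ ∘ join-reflect here here refl
  ; convex  = convex
  }
  where
  convex : ∀ {r r′ t} → node l r ≤Tree t → t ≤Tree node l r′ → ∃ λ r₀ → node l r₀ ≡ t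
  convex le le′ with between-nodes refl le le′
  ... | _ , r₀ , refl , (l≤ , _) , (≤l , _) = r₀ , cong (λ l → node l r₀) (≤Tree-antisym l≤ ≤l)

-- The mirror image of a tree.  Mirroring reverses the Tamari order.
mirror : Tree → Tree
mirror leaf       = leaf
mirror (node l r) = node (mirror r) (mirror l)

mirror-involutive : ∀ t → mirror (mirror t) ≡ t
mirror-involutive leaf       = refl
mirror-involutive (node l r) = cong₂ node (mirror-involutive l) (mirror-involutive r)

size-mirror : ∀ t → size (mirror t) ≡ size t
size-mirror leaf       = refl
size-mirror (node l r) =
  cong suc (trans (cong₂ _+_ (size-mirror r) (size-mirror l)) (ℕ.+-comm (size r) (size l)))

mirror-≤ : ∀ {s t} → s ≤Tree t → mirror t ≤Tree mirror s
mirror-≤ ε        = ε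
mirror-≤ (p ◅ ps) = mirror-≤ ps ◅◅ (mirror-↷ p ◅ ε)
  where
  mirror-↷ : ∀ {s t} → s ↷ t → mirror t ↷ mirror s
  mirror-↷ rotate    = rotate
  mirror-↷ (left p)  = right (mirror-↷ p)
  mirror-↷ (right p) = left (mirror-↷ p)

mirror-embedding : ConvexEmbedding _≤Tree_ (flip _≤Tree_) mirror
mirror-embedding = record
  { mono    = mirror-≤
  ; reflect = λ le → subst₂ _≤Tree_ (mirror-involutive _) (mirror-involutive _) (mirror-≤ le)
  ; convex  = λ {_} {_} {t} _ _ → mirror t , mirror-involutive t
  }

-- CoJoin k c e t : t is obtained from node c e by pushing e down k steps along
-- the right spine of c.
data CoJoin : ℕ → Tree → Tree → Tree → Set where
  here  : ∀ {c e} → CoJoin 0 c e (node c e)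
  there : ∀ {k b c e t} → CoJoin k c e t → CoJoin (suc k) (node b c) e (node b t)

mirror-join : ∀ {k b r t} → Join k b r t → CoJoin k (mirror r) (mirror b) (mirror t)
mirror-join here      = here
mirror-join (there j) = there (mirror-join j)

mirror-cojoin : ∀ {k c e t} → CoJoin k c e t → Join k (mirror e) (mirror c) (mirror t)
mirror-cojoin here      = here
mirror-cojoin (there j) = there (mirror-cojoin j)

cojoin-size : ∀ {k c e t} → CoJoin k c e t → size e < size t
cojoin-size here      = s≤s (ℕ.m≤n+m _ _)
cojoin-size (there j) = ℕ.<-trans (cojoin-size j) (s≤s (ℕ.m≤n+m _ _))

cojoin⇒≤ : ∀ {k c e t} → CoJoin k c e t → t ≤Tree node c e
cojoin⇒≤ here      = ε
cojoin⇒≤ (there j) = node-mono ε (cojoin⇒≤ j) ◅◅ rotate ◅ ε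

-- The mirror image of join-≤.
cojoin-≤ : ∀ {c e t} → t ≤Tree node c e →
  ∃ λ k → ∃₂ λ c′ e′ → c′ ≤Tree c × e′ ≤Tree e × CoJoin k c′ e′ t
cojoin-≤ {c} {e} {t} le =
  let k , b , r , e≤b , c≤r , j = join-≤ here (mirror-≤ le)
  in k , mirror r , mirror b
   , subst (mirror r ≤Tree_) (mirror-involutive c) (mirror-≤ c≤r)
   , subst (mirror b ≤Tree_) (mirror-involutive e) (mirror-≤ e≤b)
   , subst (CoJoin k (mirror r) (mirror b)) (mirror-involutive t) (mirror-join j)

-- Linear intervals of trees

-- LeftI k s t : inside some context, t is obtained from s by pushing the left
-- son of a node k steps down the left spine of its right son.  For k = 0 this is
-- a point.
data LeftI (k : ℕ) : Tree → Tree → Set where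
  push : ∀ {b r t} → Join k b r t → LeftI k (node b r) t
  inˡ  : ∀ {l l′ r} → LeftI k l l′ → LeftI k (node l r) (node l′ r)
  inʳ  : ∀ {l r r′} → LeftI k r r′ → LeftI k (node l r) (node l r′)

-- RightI k s t : inside some context, s is obtained from t by pushing the right
-- son of a node k steps down the right spine of its left son.
data RightI (k : ℕ) : Tree → Tree → Set where
  pull : ∀ {c e t} → CoJoin k c e t → RightI k t (node c e)
  inˡ  : ∀ {l l′ r} → RightI k l l′ → RightI k (node l r) (node l′ r)
  inʳ  : ∀ {l r r′} → RightI k r r′ → RightI k (node l r) (node l r′)

mirror-left : ∀ {k s t} → LeftI k s t → RightI k (mirror t) (mirror s)
mirror-left (push j) = pull (mirror-join j)
mirror-left (inˡ i)  = inʳ (mirror-left i)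
mirror-left (inʳ i)  = inˡ (mirror-left i)

mirror-right : ∀ {k s t} → RightI k s t → LeftI k (mirror t) (mirror s)
mirror-right (pull j) = push (mirror-cojoin j)
mirror-right (inˡ i)  = inʳ (mirror-right i)
mirror-right (inʳ i)  = inˡ (mirror-right i)

-- The interval from node b r to a join of b and r consists of the joins of b
-- and r.
leftI-sound : ∀ {k s t} → LeftI k s t → LinearIntervalOfHeight ≤Tree-isPartialOrder k (s , t)
leftI-sound (inˡ i)  = to (embedding⇔ ≤Tree-isPartialOrder ≤Tree-isPartialOrder node-embeddingˡ) (leftI-sound i)
leftI-sound (inʳ i)  = to (embedding⇔ ≤Tree-isPartialOrder ≤Tree-isPartialOrder node-embeddingʳ) (leftI-sound i)
leftI-sound (push {b} {r} {t} j) =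
  ranked⇒linear ≤Tree-isPartialOrder (λ i → Join i b r) here j
    rank mono (λ j j′ → proj₁ (join-unique j j′ refl)) (inhabited j)
  where
  rank : ∀ {s} → node b r ≤Tree s × s ≤Tree t → ∃ λ i → Join i b r s
  rank (≤s , s≤) with join-≤ here ≤s
  ... | i , _ , _ , b≤ , r≤ , j′ with join-reflect j′ j (sym (size-≤ b≤)) s≤
  ...   | ≤b , ≤r with ≤Tree-antisym b≤ ≤b | ≤Tree-antisym r≤ ≤r
  ...     | refl | refl = i , j′
  mono : ∀ {i i′ b r s s′} → i ≤ i′ → Join i b r s → Join i′ b r s′ → s ≤Tree s′
  mono _        here      j′         = join⇒≤ j′
  mono (s≤s le) (there j) (there j′) = node-mono (mono le j j′) ε
  inhabited : ∀ {k i b r t} → Join k b r t → i ≤ k → ∃ (Join i b r)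
  inhabited j         z≤n      = _ , here
  inhabited (there j) (s≤s le) = let _ , j′ = inhabited j le in _ , there j′

rightI-sound : ∀ {k s t} → RightI k s t → LinearIntervalOfHeight ≤Tree-isPartialOrder k (s , t)
rightI-sound i = from
  (embedding⇔ ≤Tree-isPartialOrder (flip-isPartialOrder ≤Tree-isPartialOrder) mirror-embedding)
  (flip-interval ≤Tree-isPartialOrder (leftI-sound (mirror-right i)))

¬leftI-loop : ∀ {k t} → ¬ LeftI (suc k) t t
¬leftI-loop i = ¬chain-loop ≤Tree-isPartialOrder (proj₁ (proj₂ (proj₂ (leftI-sound i))))

¬rightI-loop : ∀ {k t} → ¬ RightI (suc k) t t
¬rightI-loop i = ¬chain-loop ≤Tree-isPartialOrder (proj₁ (proj₂ (proj₂ (rightI-sound i))))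

left-right-disjoint : ∀ {k s t} → LeftI (2 + k) s t → RightI (2 + k) s t → ⊥
left-right-disjoint (push (there (there j))) (pull (there ()))
left-right-disjoint (push (there j)) (inʳ i)          = ℕ.<-irrefl refl (join-size j)
left-right-disjoint (inˡ i)          (pull (there j)) = ℕ.<-irrefl refl (cojoin-size j)
left-right-disjoint (inˡ i)          (inˡ i′)         = left-right-disjoint i i′
left-right-disjoint (inˡ i)          (inʳ i′)         = ¬leftI-loop i
left-right-disjoint (inʳ i)          (inˡ i′)         = ¬rightI-loop i′
left-right-disjoint (inʳ i)          (inʳ i′)         = left-right-disjoint i i′

open Intervals ≤Tree-isPartialOrder using () renaming (IsLinear to TreeIsLinear)

-- Replacing b by a smaller tree in a join gives a smaller join.
join-smaller : ∀ {k b b′ r t} → b ≤Tree b′ → Join k b′ r t → ∃ λ s → Join k b r s × s ≤Tree t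
join-smaller le here      = _ , here , node-mono le ε
join-smaller le (there j) = let _ , j′ , le′ = join-smaller le j in _ , there j′ , node-mono le′ ε

-- The interval from s to t is a point or belongs to one of the two families.
-- Right intervals of height 1 are omitted, being left intervals as well.
Classified : Tree → Tree → Set
Classified s t = s ≡ t ⊎ (∃ λ k → LeftI (suc k) s t) ⊎ (∃ λ k → RightI (2 + k) s t)

-- The case of the classification where the root takes part in a rotation and
-- the right subtree r increases to node c e.  The interval is linear only if r
-- is a proper cojoin of c and e and the root is rotated once.
classify-mixed : ∀ {k l r c e q} → r ≤Tree node c e → r ≢ node c e → Join k l c q →
  TreeIsLinear (node l r) (node q e) → ∃ λ i → RightI (2 + i) (node l r) (node q e)
classify-mixed {l = l} {r} {c} {e} r≤ r≢ j lin with cojoin-≤ r≤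
... | i , c′ , e′ , c′≤ , e′≤ , j′ with node c′ e′ ≟Tree node c e
-- If r is below some node c′ e′ strictly below node c e, then rotating the root
-- before or after reaching node c e leads to incomparable trees.
...   | no ≢ = ⊥-elim (not-linear ≤Tree-isPartialOrder lin
        ( node-mono ε (cojoin⇒≤ j′) ◅◅ rotate ◅ ε , node-mono (node-mono ε c′≤ ◅◅ join⇒≤ j) e′≤ )
        ( node-mono ε r≤ , rotate ◅ node-mono (join⇒≤ j) ε )
        (λ le → ℕ.<⇒≱ (join-size (here {l} {c′})) (left-size le))
        (λ le → ≢ (≤Tree-antisym (node-mono c′≤ e′≤) (proj₂ (join-reflect here (there here) refl le)))))
classify-mixed r≤ r≢ j lin | zero , _ , _ , _ , _ , here | yes refl = ⊥-elim (r≢ refl)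
classify-mixed r≤ r≢ here lin | suc i , _ , _ , _ , _ , j′ | yes refl = i , pull (there j′)
-- If the root takes part in at least two rotations, then the first of them can
-- be made before or after r increases to node c e.
classify-mixed {l = l} r≤ r≢ (there {c = c} j) lin | suc i , _ , _ , _ , _ , there j′ | yes refl =
  ⊥-elim (not-linear ≤Tree-isPartialOrder lin
    ( rotate ◅ ε , node-mono (join⇒≤ j) (cojoin⇒≤ j′) ◅◅ rotate ◅ ε )
    ( node-mono ε r≤ , rotate ◅ node-mono (join⇒≤ (there j)) ε )
    (λ le → ℕ.<⇒≱ (join-size (here {l} {c})) (left-size le))
    (λ le → r≢ (≤Tree-antisym r≤ (proj₂ (join-reflect here (there here) refl le)))))

classify : ∀ {s t} → s ≤Tree t → TreeIsLinear s t → Classified s t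
classify {leaf}     ε  _   = inj₁ refl
classify {node l r} le lin with join-≤ here le
... | k , l′ , r′ , l≤ , r≤ , j with l ≟Tree l′ | r ≟Tree r′
-- Both subtrees change, independently.
...   | no l≢ | no r≢ = ⊥-elim (not-linear ≤Tree-isPartialOrder lin
        ( node-mono l≤ ε , node-mono ε r≤ ◅◅ join⇒≤ j )
        ( node-mono ε r≤ , node-mono l≤ ε ◅◅ join⇒≤ j )
        (λ le′ → l≢ (≤Tree-antisym l≤ (proj₁ (join-reflect here here (sym (size-≤ l≤)) le′))))
        (λ le′ → r≢ (≤Tree-antisym r≤ (proj₂ (join-reflect here here (size-≤ l≤) le′)))))
classify {node l r} le lin | _ , _ , _ , l≤ , r≤ , here | no l≢ | yes refl =
  Sum.map (cong λ l → node l r) (Sum.map (λ (k , i) → k , inˡ i) (λ (k , i) → k , inˡ i))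
    (classify l≤ (linear-reflect ≤Tree-isPartialOrder ≤Tree-isPartialOrder node-embeddingˡ lin))
-- The left subtree changes and the root is rotated, independently.
classify {node l r} le lin | _ , _ , _ , l≤ , r≤ , there j | no l≢ | yes refl
  with join-smaller l≤ (there j)
... | _ , there j′ , s≤ = ⊥-elim (not-linear ≤Tree-isPartialOrder lin
        ( node-mono l≤ ε , join⇒≤ (there j) )
        ( join⇒≤ (there j′) , s≤ )
        (λ le′ → l≢ (≤Tree-antisym l≤ (proj₁ (join-reflect here (there j′) (sym (size-≤ l≤)) le′))))
        (λ le′ → ℕ.<⇒≱ (subst (_< _) (size-≤ l≤) (join-size j′)) (left-size le′)))
classify le lin | _ , _ , _ , _ , _ , here | yes refl | yes refl = inj₁ refl
classify le lin | suc k , _ , _ , _ , _ , j | yes refl | yes refl = inj₂ (inj₁ (k , push j))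
classify {node l r} le lin | _ , _ , _ , _ , r≤ , here | yes refl | no r≢ =
  Sum.map (cong (node l)) (Sum.map (λ (k , i) → k , inʳ i) (λ (k , i) → k , inʳ i))
    (classify r≤ (linear-reflect ≤Tree-isPartialOrder ≤Tree-isPartialOrder node-embeddingʳ lin))
classify le lin | _ , _ , _ , _ , r≤ , there j | yes refl | no r≢ =
  inj₂ (inj₂ (classify-mixed r≤ r≢ j lin))

tamari-classification : Classification ≤Tree-isPartialOrder
tamari-classification = record
  { L        = LeftI
  ; R        = RightI
  ; L-sound  = leftI-sound
  ; R-sound  = rightI-sound
  ; disjoint = left-right-disjoint
  ; complete = classify
  }

-- The dominance order on words

Word : Set
Word = List Step

-- Dom h v w g : reading v and w in parallel, w having h more up steps than v
-- beforehand, w always has at least as many up steps as v, and g more at the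
-- end.  The two words have the same length.
data Dom : ℕ → Word → Word → ℕ → Set where
  []  : ∀ {h} → Dom h [] [] h
  uu  : ∀ {h v w g} → Dom h v w g → Dom h (u ∷ v) (u ∷ w) g
  dd  : ∀ {h v w g} → Dom h v w g → Dom h (d ∷ v) (d ∷ w) g
  du  : ∀ {h v w g} → Dom (suc h) v w g → Dom h (d ∷ v) (u ∷ w) g
  ud  : ∀ {h v w g} → Dom h v w g → Dom (suc h) (u ∷ v) (d ∷ w) g

infix 4 _⊑_

-- v and w have the same numbers of up steps and of down steps, and the path v
-- stays weakly below the path w.
_⊑_ : Word → Word → Set
v ⊑ w = Dom 0 v w 0

step : ∀ x {h v w g} → Dom h v w g → Dom h (x ∷ v) (x ∷ w) g
step u = uu
step d = dd

unstep : ∀ x {h v w g} → Dom h (x ∷ v) (x ∷ w) g → Dom h v w g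
unstep u (uu D) = D
unstep d (dd D) = D

dom-refl : ∀ {h} w → Dom h w w h
dom-refl []      = []
dom-refl (x ∷ w) = step x (dom-refl w)

-- Excesses add up.
dom-trans : ∀ {h h′ g g′ i k v w x} → h + h′ ≡ i → g + g′ ≡ k →
  Dom h v w g → Dom h′ w x g′ → Dom i v x k
dom-trans refl refl [] [] = []
dom-trans eq eq′ (uu D) (uu D′) = uu (dom-trans eq eq′ D D′)
dom-trans eq eq′ (dd D) (dd D′) = dd (dom-trans eq eq′ D D′)
dom-trans eq eq′ (du D) (uu D′) = du (dom-trans (cong suc eq) eq′ D D′)
dom-trans eq eq′ (dd D) (du D′) = du (dom-trans (trans (ℕ.+-suc _ _) (cong suc eq)) eq′ D D′)
dom-trans refl eq′ (ud D) (dd D′) = ud (dom-trans refl eq′ D D′)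
dom-trans eq eq′ (uu {h} D) (ud {h′} D′) with trans (sym (ℕ.+-suc h h′)) eq
... | refl = ud (dom-trans refl eq′ D D′)
dom-trans {h} eq eq′ (du D) (ud {h′} D′) = dd (dom-trans (trans (sym (ℕ.+-suc h h′)) eq) eq′ D D′)
dom-trans {h′ = h′} eq eq′ (ud {h} D) (du D′) = uu (dom-trans (trans (ℕ.+-suc h h′) eq) eq′ D D′)

⊑-trans : ∀ {v w x} → v ⊑ w → w ⊑ x → v ⊑ x
⊑-trans = dom-trans refl refl

⊑-antisym : ∀ {v w} → v ⊑ w → w ⊑ v → v ≡ w
⊑-antisym []     []      = refl
⊑-antisym (uu D) (uu D′) = cong (u ∷_) (⊑-antisym D D′)
⊑-antisym (dd D) (dd D′) = cong (d ∷_) (⊑-antisym D D′)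

⊑-isPartialOrder : IsPartialOrder _≡_ _⊑_
⊑-isPartialOrder = record
  { isPreorder = record
    { isEquivalence = isEquivalence
    ; reflexive     = λ { refl → dom-refl _ }
    ; trans         = ⊑-trans
    }
  ; antisym = ⊑-antisym
  }

∷-embedding : ∀ x → ConvexEmbedding _⊑_ _⊑_ (x ∷_)
∷-embedding x = record { mono = step x ; reflect = unstep x ; convex = convex x }
  where
  convex : ∀ x {v w y} → x ∷ v ⊑ y → y ⊑ x ∷ w → ∃ λ y₀ → x ∷ y₀ ≡ y
  convex u (uu _) (uu _) = _ , refl
  convex d (dd _) (dd _) = _ , refl

flipStep : Step → Step
flipStep u = d
flipStep d = u

-- The reflection of a path in a vertical line: the word is read backwards and
-- the letters are exchanged.
mirrorWord : Word → Word
mirrorWord []      = []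
mirrorWord (x ∷ w) = mirrorWord w ∷ʳ flipStep x

mirrorWord-∷ʳ : ∀ w x → mirrorWord (w ∷ʳ x) ≡ flipStep x ∷ mirrorWord w
mirrorWord-∷ʳ []      x = refl
mirrorWord-∷ʳ (y ∷ w) x = cong (_∷ʳ flipStep y) (mirrorWord-∷ʳ w x)

mirrorWord-involutive : ∀ w → mirrorWord (mirrorWord w) ≡ w
mirrorWord-involutive []      = refl
mirrorWord-involutive (u ∷ w) = trans (mirrorWord-∷ʳ (mirrorWord w) d) (cong (u ∷_) (mirrorWord-involutive w))
mirrorWord-involutive (d ∷ w) = trans (mirrorWord-∷ʳ (mirrorWord w) u) (cong (d ∷_) (mirrorWord-involutive w))

dom-++ : ∀ {h g i v w v′ w′} → Dom h v w g → Dom g v′ w′ i → Dom h (v ++ v′) (w ++ w′) i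
dom-++ []     E = E
dom-++ (uu D) E = uu (dom-++ D E)
dom-++ (dd D) E = dd (dom-++ D E)
dom-++ (du D) E = du (dom-++ D E)
dom-++ (ud D) E = ud (dom-++ D E)

mirrorWord-dom : ∀ {h v w g} → Dom h v w g → Dom g (mirrorWord v) (mirrorWord w) h
mirrorWord-dom []     = []
mirrorWord-dom (uu D) = dom-++ (mirrorWord-dom D) (dd [])
mirrorWord-dom (dd D) = dom-++ (mirrorWord-dom D) (uu [])
mirrorWord-dom (du D) = dom-++ (mirrorWord-dom D) (ud [])
mirrorWord-dom (ud D) = dom-++ (mirrorWord-dom D) (du [])

mirrorWord-embedding : ConvexEmbedding _⊑_ _⊑_ mirrorWord
mirrorWord-embedding = record
  { mono    = mirrorWord-dom
  ; reflect = λ D → subst₂ _⊑_ (mirrorWord-involutive _) (mirrorWord-involutive _) (mirrorWord-dom D)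
  ; convex  = λ {_} {_} {y} _ _ → mirrorWord y , mirrorWord-involutive y
  }

-- Linear intervals of words

-- Shift k v w : the word w is obtained from d ∷ v by moving the d past k up
-- steps.
data Shift : ℕ → Word → Word → Set where
  zero : ∀ {v} → Shift 0 v (d ∷ v)
  suc  : ∀ {k v w} → Shift k v w → Shift (suc k) (u ∷ v) (u ∷ w)

-- Rise k v w : the word v is obtained from u ∷ w by moving the u past k down
-- steps.
data Rise : ℕ → Word → Word → Set where
  zero : ∀ {w} → Rise 0 (u ∷ w) w
  suc  : ∀ {k v w} → Rise k v w → Rise (suc k) (d ∷ v) (d ∷ w)

-- LeftW k v w : inside some context, a factor d u^k of v becomes u^k d in w.
data LeftW (k : ℕ) : Word → Word → Set where
  shift : ∀ {v w} → Shift k v w → LeftW k (d ∷ v) w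
  under : ∀ {x v w} → LeftW k v w → LeftW k (x ∷ v) (x ∷ w)

-- RightW k v w : inside some context, a factor d^k u of v becomes u d^k in w.
data RightW (k : ℕ) : Word → Word → Set where
  rise  : ∀ {v w} → Rise k v w → RightW k v (u ∷ w)
  under : ∀ {x v w} → RightW k v w → RightW k (x ∷ v) (x ∷ w)

shift-dom : ∀ {k v w} → Shift k v w → d ∷ v ⊑ w
shift-dom zero    = dom-refl _
shift-dom (suc s) = ⊑-trans (du (ud (dom-refl _))) (uu (shift-dom s))

rise-dom : ∀ {k v w} → Rise k v w → v ⊑ u ∷ w
rise-dom zero    = dom-refl _
rise-dom (suc r) = ⊑-trans (dd (rise-dom r)) (du (ud (dom-refl _)))

shift-unique : ∀ {k k′ v w} → Shift k v w → Shift k′ v w → k ≡ k′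
shift-unique zero    zero     = refl
shift-unique (suc s) (suc s′) = cong suc (shift-unique s s′)

-- The interval from d ∷ v to a shift of v consists of the shifts of v.
leftW-sound : ∀ {k v w} → LeftW k v w → LinearIntervalOfHeight ⊑-isPartialOrder k (v , w)
leftW-sound (under {x} l) = to (embedding⇔ ⊑-isPartialOrder ⊑-isPartialOrder (∷-embedding x)) (leftW-sound l)
leftW-sound (shift {v} {w} s) =
  ranked⇒linear ⊑-isPartialOrder (λ i → Shift i v) zero s
    (λ (≤x , x≤) → rank ≤x x≤ s) mono shift-unique (inhabited s)
  where
  rank : ∀ {k v w x} → d ∷ v ⊑ x → x ⊑ w → Shift k v w → ∃ λ i → Shift i v x
  rank D (dd D′) zero with dd E ← D | ⊑-antisym D′ (unstep d D)
  ... | refl = 0 , zero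
  rank (dd D) (du D′) (suc s) = 0 , subst (Shift 0 _) (cong (d ∷_) (sym (squeeze D D′ s))) zero
    where
    -- An element that keeps the initial d is the lower end d ∷ v: this one forces
    -- the up steps until the upper end makes its d step, and from then on the two
    -- ends agree.
    squeeze : ∀ {k v w x} → u ∷ v ⊑ x → Dom 1 x w 0 → Shift k v w → x ≡ u ∷ v
    squeeze (uu D) (ud D′) zero    = cong (u ∷_) (⊑-antisym D′ D)
    squeeze (uu D) (uu D′) (suc s) = cong (u ∷_) (squeeze D D′ s)
  rank (du D) (uu D′) (suc s) with rank (advance D) D′ s
    where
    advance : ∀ {v x} → Dom 1 (u ∷ v) x 0 → d ∷ v ⊑ x
    advance (uu D) = du D
    advance (ud D) = dd D
  ... | i , s′ = suc i , suc s′
  mono : ∀ {i i′ v w w′} → i ≤ i′ → Shift i v w → Shift i′ v w′ → w ⊑ w′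
  mono _        zero    s′       = shift-dom s′
  mono (s≤s le) (suc s) (suc s′) = uu (mono le s s′)
  inhabited : ∀ {k i v w} → Shift k v w → i ≤ k → ∃ (Shift i v)
  inhabited s       z≤n      = _ , zero
  inhabited (suc s) (s≤s le) = let _ , s′ = inhabited s le in _ , suc s′

leftW-++ : ∀ {k v w} → LeftW k v w → ∀ x → LeftW k (v ++ x) (w ++ x)
leftW-++ (shift s) x = shift (shift-++ s)
  where
  shift-++ : ∀ {k v w} → Shift k v w → Shift k (v ++ x) (w ++ x)
  shift-++ zero    = zero
  shift-++ (suc s) = suc (shift-++ s)
leftW-++ (under l) x = under (leftW-++ l x)

rightW-++ : ∀ {k v w} → RightW k v w → ∀ x → RightW k (v ++ x) (w ++ x)
rightW-++ (rise s) x = rise (rise-++ s)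
  where
  rise-++ : ∀ {k v w} → Rise k v w → Rise k (v ++ x) (w ++ x)
  rise-++ zero    = zero
  rise-++ (suc s) = suc (rise-++ s)
rightW-++ (under l) x = under (rightW-++ l x)

++-leftW : ∀ {k v w} x → LeftW k v w → LeftW k (x ++ v) (x ++ w)
++-leftW []      l = l
++-leftW (_ ∷ x) l = under (++-leftW x l)

++-rightW : ∀ {k v w} x → RightW k v w → RightW k (x ++ v) (x ++ w)
++-rightW []      l = l
++-rightW (_ ∷ x) l = under (++-rightW x l)

replicate-∷ʳ : ∀ k (x : Step) → replicate k x ∷ʳ x ≡ x ∷ replicate k x
replicate-∷ʳ zero    x = refl
replicate-∷ʳ (suc k) x = cong (x ∷_) (replicate-∷ʳ k x)

mirrorWord-replicate : ∀ k x w → mirrorWord (replicate k x ++ w) ≡ mirrorWord w ++ replicate k (flipStep x)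
mirrorWord-replicate zero    x w = sym (++-identityʳ (mirrorWord w))
mirrorWord-replicate (suc k) x w = trans (cong (_∷ʳ flipStep x) (mirrorWord-replicate k x w))
  (trans (++-assoc (mirrorWord w) _ _) (cong (mirrorWord w ++_) (replicate-∷ʳ k (flipStep x))))

shift-form : ∀ {k v w} → Shift k v w → ∃ λ y → v ≡ replicate k u ++ y × w ≡ replicate k u ++ d ∷ y
shift-form zero    = _ , refl , refl
shift-form (suc s) = let y , eq , eq′ = shift-form s in y , cong (u ∷_) eq , cong (u ∷_) eq′

rise-form : ∀ {k v w} → Rise k v w → ∃ λ y → v ≡ replicate k d ++ u ∷ y × w ≡ replicate k d ++ y
rise-form zero    = _ , refl , refl
rise-form (suc s) = let y , eq , eq′ = rise-form s in y , cong (d ∷_) eq , cong (d ∷_) eq′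

-- Reflection exchanges the two families.
mirrorWord-leftW : ∀ {k v w} → LeftW k v w → RightW k (mirrorWord v) (mirrorWord w)
mirrorWord-leftW (under {x} l) = rightW-++ (mirrorWord-leftW l) _
mirrorWord-leftW {k} (shift s) with shift-form s
... | y , refl , refl = subst₂ (RightW k)
    (trans (sym (++-assoc (mirrorWord y) _ _)) (cong (_∷ʳ u) (sym (mirrorWord-replicate k u y))))
    (trans (sym (++-assoc (mirrorWord y) _ _)) (sym (mirrorWord-replicate k u (d ∷ y))))
    (++-rightW (mirrorWord y) (rise (base k)))
  where
  base : ∀ k → Rise k (replicate k d ∷ʳ u) (replicate k d)
  base zero    = zero
  base (suc k) = suc (base k)

mirrorWord-rightW : ∀ {k v w} → RightW k v w → LeftW k (mirrorWord v) (mirrorWord w)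
mirrorWord-rightW (under {x} l) = leftW-++ (mirrorWord-rightW l) _
mirrorWord-rightW {k} (rise s) with rise-form s
... | y , refl , refl = subst₂ (LeftW k)
    (trans (sym (++-assoc (mirrorWord y) _ _)) (sym (mirrorWord-replicate k d (u ∷ y))))
    (trans (sym (++-assoc (mirrorWord y) _ _)) (cong (_∷ʳ d) (sym (mirrorWord-replicate k d y))))
    (++-leftW (mirrorWord y) (shift (base k)))
  where
  base : ∀ k → Shift k (replicate k u) (replicate k u ∷ʳ d)
  base zero    = zero
  base (suc k) = suc (base k)

rightW-sound : ∀ {k v w} → RightW k v w → LinearIntervalOfHeight ⊑-isPartialOrder k (v , w)
rightW-sound r =
  from (embedding⇔ ⊑-isPartialOrder ⊑-isPartialOrder mirrorWord-embedding) (leftW-sound (mirrorWord-rightW r))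

leftW-rightW-disjoint : ∀ {k v w} → LeftW (2 + k) v w → RightW (2 + k) v w → ⊥
leftW-rightW-disjoint (shift (suc s)) (rise (suc ()))
leftW-rightW-disjoint (under l)       (under r) = leftW-rightW-disjoint l r

open Intervals ⊑-isPartialOrder using () renaming (IsLinear to WordIsLinear)

-- Interpolation: an excess of suc h is the sum of excesses of 1 and h.
dom-split : ∀ {h v w} → Dom (suc h) v w 0 → ∃ λ y → Dom 1 v y 0 × Dom h y w 0
dom-split (uu D) = let y , D₁ , D₂ = dom-split D in u ∷ y , uu D₁ , uu D₂
dom-split (dd D) = let y , D₁ , D₂ = dom-split D in d ∷ y , dd D₁ , dd D₂
dom-split (du D) = let y , D₁ , D₂ = dom-split D in d ∷ y , dd D₁ , du D₂
dom-split (ud {v = v} D) = d ∷ v , ud (dom-refl v) , dd D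

-- With an excess of at least 2, the interpolation is not unique.
dom-split₂ : ∀ {h v w} → Dom (2 + h) v w 0 → ∃₂ λ x y →
  (Dom 1 v x 0 × Dom (suc h) x w 0) × (Dom 1 v y 0 × Dom (suc h) y w 0) × ¬ (y ⊑ x)
dom-split₂ (uu D) with dom-split₂ D
... | x , y , (a , b) , (c , e) , y⋢x =
  u ∷ x , u ∷ y , (uu a , uu b) , (uu c , uu e) , y⋢x ∘ unstep u
dom-split₂ (dd D) with dom-split₂ D
... | x , y , (a , b) , (c , e) , y⋢x =
  d ∷ x , d ∷ y , (dd a , dd b) , (dd c , dd e) , y⋢x ∘ unstep d
dom-split₂ (du D) with dom-split₂ D
... | x , y , (a , b) , (c , e) , y⋢x =
  d ∷ x , d ∷ y , (dd a , du b) , (dd c , du e) , y⋢x ∘ unstep d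
dom-split₂ (ud {v = v} D) with dom-split D
... | y , a , b = d ∷ v , u ∷ y , (ud (dom-refl v) , dd D) , (uu a , ud b) , λ ()

-- The interval from v to w is a point or belongs to one of the two families.
ClassifiedW : Word → Word → Set
ClassifiedW v w = v ≡ w ⊎ (∃ λ k → LeftW (suc k) v w) ⊎ (∃ λ k → RightW (2 + k) v w)

-- The classification for words that differ in the first step.  In each linear
-- case the region between the paths grows by one cell in its own direction; a
-- change of direction, or a region of width 2, gives incomparable elements.
classify-du : ∀ {v w} → Dom 1 v w 0 → WordIsLinear (d ∷ v) (u ∷ w) →
  (∃ λ k → Shift (suc k) v (u ∷ w)) ⊎ (∃ λ k → Rise (2 + k) (d ∷ v) w)
classify-du {u ∷ v} {d ∷ w} (ud D) lin with ≡-dec _≟_ v w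
... | yes refl = inj₁ (0 , suc zero)
... | no v≢w   = ⊥-elim (not-linear ⊑-isPartialOrder lin
        ( du (ud (dom-refl v)) , uu (dd D) )
        ( dd (uu D) , du (ud (dom-refl w)) )
        (λ ())
        (λ { (du (ud E)) → v≢w (⊑-antisym D E) }))
classify-du (uu {v = v} {w} D) lin with classify-du D
  (linear-reflect ⊑-isPartialOrder ⊑-isPartialOrder (∷-embedding u)
    (linear-sub ⊑-isPartialOrder (du (ud (dom-refl v))) (dom-refl (u ∷ u ∷ w)) lin))
... | inj₁ (k , s) = inj₁ (suc k , suc s)
... | inj₂ (k , suc (suc {v = v′} {w′} r)) with rise-dom (suc r)
...   | du E = ⊥-elim (not-linear ⊑-isPartialOrder lin
        ( du (ud (dom-refl (d ∷ v′))) , uu (du (dd E)) )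
        ( dd (uu (du E)) , du (uu (ud (dom-refl (d ∷ w′)))) )
        (λ ())
        (λ { (du (ud ())) }))
classify-du (dd {v = v} {w} D) lin with classify-du D
  (linear-reflect ⊑-isPartialOrder ⊑-isPartialOrder (∷-embedding d)
    (linear-sub ⊑-isPartialOrder (dom-refl (d ∷ d ∷ v)) (du (ud (dom-refl w))) lin))
... | inj₂ (k , r)            = inj₂ (suc k , suc r)
... | inj₁ (0 , suc zero)     = inj₂ (0 , suc (suc zero))
... | inj₁ (suc k , suc (suc {v = v′} {w′} s)) = ⊥-elim (not-linear ⊑-isPartialOrder lin
        ( du (dd (ud (dom-refl (u ∷ v′)))) , uu (dd (shift-dom (suc s))) )
        ( dd (shift-dom (suc (suc s))) , du (ud (dom-refl (u ∷ w′))) )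
        (λ ())
        (λ { (du (ud ())) }))
classify-du (du D) lin with dom-split₂ D
... | x , y , (a , b) , (c , e) , y⋢x = ⊥-elim (not-linear ⊑-isPartialOrder lin
        ( du (dd a) , uu (du b) )
        ( dd (du c) , du (uu e) )
        (λ ())
        (λ { (du (ud E)) → y⋢x E }))

classifyW : ∀ {v w} → v ⊑ w → WordIsLinear v w → ClassifiedW v w
classifyW []     _   = inj₁ refl
classifyW (du D) lin with classify-du D lin
... | inj₁ (k , s) = inj₂ (inj₁ (k , shift s))
... | inj₂ (k , r) = inj₂ (inj₂ (k , rise r))
classifyW (uu D) lin = Sum.map (cong (u ∷_)) (Sum.map (λ (k , l) → k , under l) (λ (k , r) → k , under r))
  (classifyW D (linear-reflect ⊑-isPartialOrder ⊑-isPartialOrder (∷-embedding u) lin))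
classifyW (dd D) lin = Sum.map (cong (d ∷_)) (Sum.map (λ (k , l) → k , under l) (λ (k , r) → k , under r))
  (classifyW D (linear-reflect ⊑-isPartialOrder ⊑-isPartialOrder (∷-embedding d) lin))

word-classification : Classification ⊑-isPartialOrder
word-classification = record
  { L        = LeftW
  ; R        = RightW
  ; L-sound  = leftW-sound
  ; R-sound  = rightW-sound
  ; disjoint = leftW-rightW-disjoint
  ; complete = classifyW
  }

-- Dyck paths as words

-- Path a w b : the word w leads from height a to height b without going below
-- height 0.
data Path : ℕ → Word → ℕ → Set where
  []   : ∀ {a} → Path a [] a
  up   : ∀ {a w b} → Path (suc a) w b → Path a (u ∷ w) b
  down : ∀ {a w b} → Path a w b → Path (suc a) (d ∷ w) b

path-++ : ∀ {a b c v w} → Path a v b → Path b w c → Path a (v ++ w) c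
path-++ []       q = q
path-++ (up p)   q = up (path-++ p q)
path-++ (down p) q = down (path-++ p q)

path-mirror : ∀ {a w b} → Path a w b → Path b (mirrorWord w) a
path-mirror []       = []
path-mirror (up p)   = path-++ (path-mirror p) (down [])
path-mirror (down p) = path-++ (path-mirror p) (up [])

path-# : ∀ {a w b} → Path a w b → a + # u w ≡ b + # d w
path-# []                       = refl
path-# (up {a} {w} p)           = trans (ℕ.+-suc a (# u w)) (path-# p)
path-# (down {w = w} {b = b} p) = trans (cong suc (path-# p)) (sym (ℕ.+-suc b (# d w)))

path-prefixes : ∀ {a w b} → Path a w b → All (λ v → # d v ≤ a + # u v) (inits w)
path-prefixes p = z≤n ∷ tail p
  where
  tail : ∀ {a w b} → Path a w b → All (λ v → # d v ≤ a + # u v) (Data.List.Base.Inits.tail w)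
  tail []           = []
  tail (up {a} p)   = z≤n ∷ All.map⁺ (All.map (λ {v} le → subst (# d v ≤_) (sym (ℕ.+-suc a (# u v))) le) (tail p))
  tail (down p)     = s≤s z≤n ∷ All.map⁺ (All.map s≤s (tail p))

prefixes-path : ∀ {a} w {b} → (∀ i → # d (take i w) ≤ a + # u (take i w)) →
  a + # u w ≡ b + # d w → Path a w b
prefixes-path {a} [] {b} le eq with trans (sym (ℕ.+-identityʳ a)) (trans eq (ℕ.+-identityʳ b))
... | refl = []
prefixes-path {a} (u ∷ w) le eq = up (prefixes-path w
  (λ i → subst (# d (take i w) ≤_) (ℕ.+-suc a _) (le (suc i)))
  (trans (sym (ℕ.+-suc a _)) eq))
prefixes-path {zero}  (d ∷ w) le eq with () ← le 1
prefixes-path {suc a} (d ∷ w) {b} le eq = down (prefixes-path w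
  (λ i → ℕ.≤-pred (le (suc i)))
  (ℕ.suc-injective (trans eq (ℕ.+-suc b _))))

-- DyckWord n w : w is the word of a Dyck path of size n.
DyckWord : ℕ → Word → Set
DyckWord n w = Path 0 w 0 × # u w ≡ n

word-dyck : ∀ {n} (P : Dyck n) → DyckWord n (word P)
word-dyck P = prefixes-path (word P) (λ i → All.lookup (prefixes P) (take∈inits i (word P)))
                (trans (#u≡n P) (sym (#d≡n P)))
            , #u≡n P

dyck-word : ∀ {n w} → DyckWord n w → ∃ λ (P : Dyck n) → word P ≡ w
dyck-word {w = w} (p , eq) = dyck w eq (trans (sym (path-# p)) eq) (path-prefixes p) , refl

mirrorWord-dyck : ∀ {n w} → DyckWord n w → DyckWord n (mirrorWord w)
mirrorWord-dyck {w = w} (p , eq) = path-mirror p , trans (#u-mirror w) (trans (sym (path-# p)) eq)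
  where
  #u-∷ʳ : ∀ v x → # u (v ++ x ∷ []) ≡ # u (x ∷ v)
  #u-∷ʳ []      x = refl
  #u-∷ʳ (u ∷ v) u = cong suc (#u-∷ʳ v u)
  #u-∷ʳ (u ∷ v) d = cong suc (#u-∷ʳ v d)
  #u-∷ʳ (d ∷ v) u = #u-∷ʳ v u
  #u-∷ʳ (d ∷ v) d = #u-∷ʳ v d
  #u-mirror : ∀ w → # u (mirrorWord w) ≡ # d w
  #u-mirror []      = refl
  #u-mirror (u ∷ w) = trans (#u-∷ʳ (mirrorWord w) d) (#u-mirror w)
  #u-mirror (d ∷ w) = trans (#u-∷ʳ (mirrorWord w) u) (cong suc (#u-mirror w))

-- The height after i steps of a path starting at height a.
heightAt : ℕ → Word → ℕ → ℕ
heightAt a w i = (a + # u (take i w)) ∸ # d (take i w)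

heightAt-up : ∀ a w i → heightAt a (u ∷ w) (suc i) ≡ heightAt (suc a) w i
heightAt-up a w i = cong (_∸ # d (take i w)) (ℕ.+-suc a (# u (take i w)))

shift-height : ∀ h a → h + suc h + a ≡ h + h + suc a
shift-height h a = trans (cong (_+ a) (ℕ.+-suc h h)) (sym (ℕ.+-suc (h + h) a))

-- A word dominating a path is a path.  As each excess up step replaces a down
-- step, an excess of h raises the height by h + h.
dom-path : ∀ {h a e v w b} → e ≡ h + h + a → Dom h v w 0 → Path a v b → Path e w b
dom-path refl [] [] = []
dom-path {h} {a} refl (uu D) (up p) = up (dom-path (sym (ℕ.+-suc (h + h) a)) D p)
dom-path {h} {suc a} eq (dd D) (down p) with trans eq (ℕ.+-suc (h + h) a)
... | refl = down (dom-path refl D p)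
dom-path {h} {suc a} refl (du D) (down p) = up (dom-path (cong suc (sym (shift-height h a))) D p)
dom-path {suc h} {a} refl (ud D) (up p) = down (dom-path (shift-height h a) D p)

dom-# : ∀ {h v w g} → Dom h v w g → h + # u w ≡ g + # u v
dom-# []         = refl
dom-# (uu D)     = trans (ℕ.+-suc _ _) (trans (cong suc (dom-# D)) (sym (ℕ.+-suc _ _)))
dom-# (dd D)     = dom-# D
dom-# (du D)     = trans (ℕ.+-suc _ _) (dom-# D)
dom-# (ud D)     = trans (cong suc (dom-# D)) (sym (ℕ.+-suc _ _))

dom-dyck : ∀ {n v w} → DyckWord n v → v ⊑ w → DyckWord n w
dom-dyck (p , eq) D = dom-path refl D p , trans (dom-# D) eq

heights-mono : ∀ {h a e v w b} → e ≡ h + h + a → Dom h v w 0 → Path a v b →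
  ∀ i → heightAt a v i ≤ heightAt e w i
heights-mono {h} {a} refl _ _ zero = ℕ.+-monoˡ-≤ 0 (ℕ.m≤n+m a (h + h))
heights-mono refl [] [] (suc i) = ℕ.≤-refl
heights-mono {h} {a} {e} refl (uu {v = v} {w} D) (up p) (suc i) =
  subst₂ _≤_ (sym (heightAt-up a v i)) (sym (heightAt-up e w i))
    (heights-mono (sym (ℕ.+-suc (h + h) a)) D p i)
heights-mono {h} {suc a} eq (dd D) (down p) (suc i) with trans eq (ℕ.+-suc (h + h) a)
... | refl = heights-mono refl D p i
heights-mono {h} {suc a} {e} refl (du {v = v} {w} D) (down p) (suc i) =
  subst (heightAt a v i ≤_) (sym (heightAt-up e w i))
    (heights-mono (cong suc (sym (shift-height h a))) D p i)
heights-mono {suc h} {a} refl (ud {v = v} {w} D) (up p) (suc i) =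
  subst (_≤ heightAt (h + suc h + a) w i) (sym (heightAt-up a v i)) (heights-mono (shift-height h a) D p i)

heights-reflect : ∀ {h a e v w} → e ≡ h + h + a → Path a v 0 → Path e w 0 → length v ≡ length w →
  (∀ i → i < length v → heightAt a v i ≤ heightAt e w i) → Dom h v w 0
heights-reflect {zero} eq [] [] len le = []
heights-reflect {h} {a} {e} refl (up {w = v} p) (up {w = w} q) len le =
  uu (heights-reflect (sym (ℕ.+-suc (h + h) a)) p q (ℕ.suc-injective len)
    λ i i< → subst₂ _≤_ (heightAt-up a v i) (heightAt-up e w i) (le (suc i) (s≤s i<)))
heights-reflect {h} {suc a} eq (down p) (down q) len le with trans eq (ℕ.+-suc (h + h) a)
... | refl = dd (heights-reflect refl p q (ℕ.suc-injective len) λ i i< → le (suc i) (s≤s i<))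
heights-reflect {h} {suc a} {e} refl (down {w = v} p) (up {w = w} q) len le =
  du (heights-reflect (cong suc (sym (shift-height h a))) p q (ℕ.suc-injective len)
    λ i i< → subst (heightAt a v i ≤_) (heightAt-up e w i) (le (suc i) (s≤s i<)))
heights-reflect {suc h} {a} refl (up {w = v} p) (down {w = w} q) len le =
  ud (heights-reflect (shift-height h a) p q (ℕ.suc-injective len)
    λ i i< → subst (_≤ heightAt (h + suc h + a) w i) (heightAt-up a v i) (le (suc i) (s≤s i<)))
-- Without an excess the words cannot continue with u and d, since the height
-- of the next step would be larger in v than in w.
heights-reflect {zero} {suc a} refl (up {w = v} p) (down q) len le =
  ⊥-elim (ℕ.<⇒≱ (ℕ.+-monoˡ-< 0 (ℕ.m<n⇒m<1+n (ℕ.n<1+n a)))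
    (subst (_≤ a + 0) (heightAt-up (suc a) v 0) (le 1 (s≤s (nonempty p)))))
  where
  nonempty : ∀ {a w} → Path (suc a) w 0 → 1 ≤ length w
  nonempty (up p)   = s≤s z≤n
  nonempty (down p) = s≤s z≤n

length-# : ∀ w → length w ≡ # u w + # d w
length-# []      = refl
length-# (u ∷ w) = cong suc (length-# w)
length-# (d ∷ w) = trans (cong suc (length-# w)) (sym (ℕ.+-suc (# u w) (# d w)))

length-word : ∀ {n} (P : Dyck n) → length (word P) ≡ 2 * n
length-word {n} P = trans (length-# (word P))
  (cong₂ _+_ (#u≡n P) (trans (#d≡n P) (sym (ℕ.+-identityʳ n))))

-- Comparing the heights of all steps amounts to dominance of words.
word-embedding : ∀ {n} → ConvexEmbedding (_≤Dyck_ {n}) _⊑_ word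
word-embedding {n} = record
  { mono    = λ {P} {Q} P≤Q → heights-reflect refl (proj₁ (word-dyck P)) (proj₁ (word-dyck Q))
                (trans (length-word P) (sym (length-word Q)))
                λ i i< → let i<2n = subst (i <_) (length-word P) i< in
                  subst (λ j → stepHeight P j ≤ stepHeight Q j) (toℕ-fromℕ< i<2n) (P≤Q (fromℕ< i<2n))
  ; reflect = λ {P} D i → heights-mono refl D (proj₁ (word-dyck P)) (toℕ i)
  ; convex  = λ {P} D _ → dyck-word (dom-dyck (word-dyck P) D)
  }

-- Trees and Dyck words

-- The Dyck word of a tree, followed by x.
encode : Tree → Word → Word
encode leaf       x = x
encode (node l r) x = u ∷ encode l (d ∷ encode r x)

encode-path : ∀ t {a x b} → Path a x b → Path a (encode t x) b
encode-path leaf       p = p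
encode-path (node l r) p = up (encode-path l (down (encode-path r p)))

encode-# : ∀ t x → # u (encode t x) ≡ size t + # u x
encode-# leaf       x = refl
encode-# (node l r) x = cong suc (trans (encode-# l (d ∷ encode r x))
  (trans (cong (size l +_) (encode-# r x)) (sym (ℕ.+-assoc (size l) (size r) (# u x)))))

-- The words that can follow the word of a tree: those that do not start with an
-- up step.
data Stop : Word → Set where
  []  : Stop []
  d∷_ : ∀ w → Stop (d ∷ w)

encode-injective : ∀ t t′ {x x′} → Stop x → Stop x′ → encode t x ≡ encode t′ x′ → t ≡ t′ × x ≡ x′
encode-injective leaf       leaf         _  _  eq = refl , eq
encode-injective leaf       (node _ _)   [] _  ()
encode-injective (node _ _) leaf         _  [] ()
encode-injective (node l r) (node l′ r′) s  s′ eq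
  with encode-injective l l′ (d∷ _) (d∷ _) (∷-injectiveʳ eq)
... | refl , eq′ with encode-injective r r′ s s′ (∷-injectiveʳ eq′)
...   | refl , eq″ = refl , eq″

-- For each tree of the list, a down step followed by the word of the tree.
after : ∀ {a} → Vec Tree a → Word
after []       = []
after (t ∷ ts) = d ∷ encode t (after ts)

-- In a path from height a to height 0, the a unmatched down steps separate the
-- words of suc a trees.
decode : ∀ {a w} → Path a w 0 → ∃₂ λ t (ts : Vec Tree a) → encode t (after ts) ≡ w
decode [] = leaf , [] , refl
decode (up p) with decode p
... | l , r ∷ ts , eq = node l r , ts , cong (u ∷_) eq
decode (down p) with decode p
... | t , ts , eq = leaf , t ∷ ts , cong (d ∷_) eq

-- The Dyck word of a tree.
code : Tree → Word
code t = encode t []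

-- The trees of height at most h.
treesUpTo : ℕ → List Tree
treesUpTo zero    = leaf ∷ []
treesUpTo (suc h) = leaf ∷ cartesianProductWith node (treesUpTo h) (treesUpTo h)

treesUpTo-unique : ∀ h → Unique (treesUpTo h)
treesUpTo-unique zero    = [] ∷ []
treesUpTo-unique (suc h) = All.tabulate leaf∉ ∷
  Unique.cartesianProductWith⁺ node (λ { refl → refl , refl }) (treesUpTo-unique h) (treesUpTo-unique h)
  where
  leaf∉ : ∀ {t} → t ∈ cartesianProductWith node (treesUpTo h) (treesUpTo h) → leaf ≢ t
  leaf∉ i refl with ∈-cartesianProductWith⁻ node (treesUpTo h) (treesUpTo h) i
  ... | _ , _ , _ , _ , ()

treesUpTo-complete : ∀ h t → size t ≤ h → t ∈ treesUpTo h
treesUpTo-complete zero    leaf       _        = here refl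
treesUpTo-complete (suc h) leaf       _        = here refl
treesUpTo-complete (suc h) (node l r) (s≤s le) = there (∈-cartesianProductWith⁺ node
  (treesUpTo-complete h l (ℕ.≤-trans (ℕ.m≤m+n (size l) (size r)) le))
  (treesUpTo-complete h r (ℕ.≤-trans (ℕ.m≤n+m (size r) (size l)) le)))

-- The trees of size n, whose height is at most n.
trees : ℕ → List Tree
trees n = filter (λ t → size t ℕ.≟ n) (treesUpTo n)

trees-enumerates : ∀ n → Enumerates (trees n) (λ t → size t ≡ n)
trees-enumerates n =
  Unique.filter⁺ size≟n (treesUpTo-unique n) ,
  λ t → mk⇔ (proj₂ ∘ ∈-filter⁻ size≟n {xs = treesUpTo n})
            (λ eq → ∈-filter⁺ size≟n (treesUpTo-complete n t (ℕ.≤-reflexive eq)) eq)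
  where size≟n = λ t → size t ℕ.≟ n

words-enumerates : ∀ n → Enumerates (map code (trees n)) (DyckWord n)
words-enumerates n =
  Unique.map⁺ (λ eq → proj₁ (encode-injective _ _ [] [] eq)) (proj₁ (trees-enumerates n)) ,
  λ w → mk⇔ sound complete
  where
  size-code : ∀ t → # u (code t) ≡ size t
  size-code t = trans (encode-# t []) (ℕ.+-identityʳ (size t))
  sound : ∀ {w} → w ∈ map code (trees n) → DyckWord n w
  sound i with ∈-map⁻ code i
  ... | t , t∈ , refl = encode-path t [] , trans (size-code t) (to (proj₂ (trees-enumerates n) t) t∈)
  complete : ∀ {w} → DyckWord n w → w ∈ map code (trees n)
  complete (p , eq) with decode p
  ... | t , [] , refl = ∈-map⁺ code (from (proj₂ (trees-enumerates n) t) (trans (sym (size-code t)) eq))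

-- Counting the intervals of the left families above a given lower end

-- The trees t with Join k b r t, of which there is at most one.
joins : ℕ → Tree → Tree → List Tree
joins zero    b r          = node b r ∷ []
joins (suc k) b leaf       = []
joins (suc k) b (node c e) = map (λ t → node t e) (joins k b c)

∈-joins⁻ : ∀ k {b} r {t} → t ∈ joins k b r → Join k b r t
∈-joins⁻ zero    r          (here refl) = here
∈-joins⁻ (suc k) (node c e) i with ∈-map⁻ _ i
... | _ , j , refl = there (∈-joins⁻ k c j)

∈-joins⁺ : ∀ {k b r t} → Join k b r t → t ∈ joins k b r
∈-joins⁺ here      = here refl
∈-joins⁺ (there j) = ∈-map⁺ _ (∈-joins⁺ j)

joins-unique : ∀ k b r → Unique (joins k b r)
joins-unique zero    b r          = [] ∷ []
joins-unique (suc k) b leaf       = []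
joins-unique (suc k) b (node c e) = Unique.map⁺ (λ { refl → refl }) (joins-unique k b c)

-- The words w with Shift k v w, of which there is at most one.
shifts : ℕ → Word → List Word
shifts zero    v       = (d ∷ v) ∷ []
shifts (suc k) []      = []
shifts (suc k) (u ∷ v) = map (u ∷_) (shifts k v)
shifts (suc k) (d ∷ v) = []

∈-shifts⁻ : ∀ k v {w} → w ∈ shifts k v → Shift k v w
∈-shifts⁻ zero    v       (here refl) = zero
∈-shifts⁻ (suc k) (u ∷ v) i with ∈-map⁻ _ i
... | _ , j , refl = suc (∈-shifts⁻ k v j)

∈-shifts⁺ : ∀ {k v w} → Shift k v w → w ∈ shifts k v
∈-shifts⁺ zero    = here refl
∈-shifts⁺ (suc s) = ∈-map⁺ _ (∈-shifts⁺ s)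

shifts-unique : ∀ k v → Unique (shifts k v)
shifts-unique zero    v       = [] ∷ []
shifts-unique (suc k) []      = []
shifts-unique (suc k) (u ∷ v) = Unique.map⁺ ∷-injectiveʳ (shifts-unique k v)
shifts-unique (suc k) (d ∷ v) = []

-- The trees t with LeftI (suc k) s t, for a given s.
leftTrees : ℕ → Tree → List Tree
leftTrees k leaf       = []
leftTrees k (node l r) =
  joins (suc k) l r ++ (map (λ t → node t r) (leftTrees k l) ++ map (node l) (leftTrees k r))

∈-leftTrees⁻ : ∀ k s {t} → t ∈ leftTrees k s → LeftI (suc k) s t
∈-leftTrees⁻ k (node l r) i with ∈-++⁻ (joins (suc k) l r) i
... | inj₁ j = push (∈-joins⁻ (suc k) r j)
... | inj₂ j with ∈-++⁻ (map (λ t → node t r) (leftTrees k l)) j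
...   | inj₁ m with ∈-map⁻ _ m
...     | _ , m′ , refl = inˡ (∈-leftTrees⁻ k l m′)
∈-leftTrees⁻ k (node l r) i | inj₂ j | inj₂ m with ∈-map⁻ _ m
...     | _ , m′ , refl = inʳ (∈-leftTrees⁻ k r m′)

∈-leftTrees⁺ : ∀ {k s t} → LeftI (suc k) s t → t ∈ leftTrees k s
∈-leftTrees⁺ (push j) = ∈-++⁺ˡ (∈-joins⁺ j)
∈-leftTrees⁺ {k} {node l r} (inˡ i) =
  ∈-++⁺ʳ (joins (suc k) l r) (∈-++⁺ˡ (∈-map⁺ _ (∈-leftTrees⁺ i)))
∈-leftTrees⁺ {k} {node l r} (inʳ i) =
  ∈-++⁺ʳ (joins (suc k) l r) (∈-++⁺ʳ (map _ (leftTrees k l)) (∈-map⁺ _ (∈-leftTrees⁺ i)))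

leftTrees-unique : ∀ k s → Unique (leftTrees k s)
leftTrees-unique k leaf       = []
leftTrees-unique k (node l r) =
  Unique.++⁺ (joins-unique (suc k) l r)
    (Unique.++⁺ (Unique.map⁺ (λ { refl → refl }) (leftTrees-unique k l))
                (Unique.map⁺ (λ { refl → refl }) (leftTrees-unique k r))
                children-disjoint)
    root-disjoint
  where
  children-disjoint : ∀ {t} → ¬ (t ∈ map (λ t → node t r) (leftTrees k l) × t ∈ map (node l) (leftTrees k r))
  children-disjoint (i , j) with ∈-map⁻ _ i | ∈-map⁻ _ j
  ... | _ , m , refl | _ , _ , refl = ¬leftI-loop (∈-leftTrees⁻ k l m)
  not-push : ∀ {t} → Join (suc k) l r t → ¬ (t ∈ map (λ t → node t r) (leftTrees k l) ⊎ t ∈ map (node l) (leftTrees k r))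
  not-push (there j) (inj₁ i) with ∈-map⁻ _ i
  ... | _ , _ , ()
  not-push (there j) (inj₂ i) with ∈-map⁻ _ i
  ... | _ , _ , refl = ℕ.<-irrefl refl (join-size j)
  root-disjoint : ∀ {t} → ¬ (t ∈ joins (suc k) l r ×
    t ∈ map (λ t → node t r) (leftTrees k l) ++ map (node l) (leftTrees k r))
  root-disjoint (i , j) = not-push (∈-joins⁻ (suc k) r i) (∈-++⁻ (map (λ t → node t r) (leftTrees k l)) j)

-- The words w with LeftW (suc k) v w, for a given v.
leftWords : ℕ → Word → List Word
leftWords k []      = []
leftWords k (u ∷ v) = map (u ∷_) (leftWords k v)
leftWords k (d ∷ v) = shifts (suc k) v ++ map (d ∷_) (leftWords k v)

∈-leftWords⁻ : ∀ k v {w} → w ∈ leftWords k v → LeftW (suc k) v w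
∈-leftWords⁻ k (u ∷ v) i with ∈-map⁻ _ i
... | _ , j , refl = under (∈-leftWords⁻ k v j)
∈-leftWords⁻ k (d ∷ v) i with ∈-++⁻ (shifts (suc k) v) i
... | inj₁ j = shift (∈-shifts⁻ (suc k) v j)
... | inj₂ j with ∈-map⁻ _ j
...   | _ , m , refl = under (∈-leftWords⁻ k v m)

∈-leftWords⁺ : ∀ {k v w} → LeftW (suc k) v w → w ∈ leftWords k v
∈-leftWords⁺ (shift s)               = ∈-++⁺ˡ (∈-shifts⁺ s)
∈-leftWords⁺ (under {u} l)           = ∈-map⁺ _ (∈-leftWords⁺ l)
∈-leftWords⁺ {k} (under {d} {v} l)   = ∈-++⁺ʳ (shifts (suc k) v) (∈-map⁺ _ (∈-leftWords⁺ l))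

leftWords-unique : ∀ k v → Unique (leftWords k v)
leftWords-unique k []      = []
leftWords-unique k (u ∷ v) = Unique.map⁺ ∷-injectiveʳ (leftWords-unique k v)
leftWords-unique k (d ∷ v) =
  Unique.++⁺ (shifts-unique (suc k) v) (Unique.map⁺ ∷-injectiveʳ (leftWords-unique k v)) disjoint
  where
  disjoint : ∀ {w} → ¬ (w ∈ shifts (suc k) v × w ∈ map (d ∷_) (leftWords k v))
  disjoint (i , j) with ∈-shifts⁻ (suc k) v i | ∈-map⁻ _ j
  ... | suc _ | _ , _ , ()

-- The word of r starts with u^k if and only if the left spine of r has at least
-- k nodes.
length-shifts : ∀ k b r {x} → Stop x → length (shifts (suc k) (encode r x)) ≡ length (joins (suc k) b r)
length-shifts k       b leaf       []     = refl
length-shifts k       b leaf       (d∷ _) = refl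
length-shifts zero    b (node c e) s      = refl
length-shifts (suc k) b (node c e) {x} s  =
  trans (length-map (u ∷_) (shifts (suc k) (encode c (d ∷ encode e x))))
    (trans (length-shifts k b c (d∷ encode e x)) (sym (length-map _ (joins (suc k) b c))))

-- A factor d u^k with k positive starts at the d of some node, and the u^k
-- cannot reach beyond the word of the right son of this node.
length-leftWords : ∀ k t {x} → Stop x →
  length (leftWords k (encode t x)) ≡ length (leftTrees k t) + length (leftWords k x)
length-leftWords k leaf       s = refl
length-leftWords k (node l r) {x} s = begin
  length (map (u ∷_) (leftWords k (encode l (d ∷ y))))
    ≡⟨ length-map (u ∷_) (leftWords k (encode l (d ∷ y))) ⟩
  length (leftWords k (encode l (d ∷ y)))
    ≡⟨ length-leftWords k l (d∷ y) ⟩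
  L + length (shifts (suc k) y ++ map (d ∷_) (leftWords k y))
    ≡⟨ cong (L +_) (length-++ (shifts (suc k) y)) ⟩
  L + (length (shifts (suc k) y) + length (map (d ∷_) (leftWords k y)))
    ≡⟨ cong (L +_) (cong₂ _+_ (length-shifts k l r s)
         (trans (length-map (d ∷_) (leftWords k y)) (length-leftWords k r s))) ⟩
  L + (T + (R + length (leftWords k x)))
    ≡⟨ rearrange L T R _ ⟩
  T + (L + R) + length (leftWords k x)
    ≡⟨ cong (_+ length (leftWords k x)) (trans
         (cong (T +_) (sym (trans (length-++ (map _ (leftTrees k l)))
           (cong₂ _+_ (length-map _ (leftTrees k l)) (length-map _ (leftTrees k r))))))
         (sym (length-++ (joins (suc k) l r)))) ⟩
  length (leftTrees k (node l r)) + length (leftWords k x) ∎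
  where
  open ≡-Reasoning
  y = encode r x
  T = length (joins (suc k) l r)
  L = length (leftTrees k l)
  R = length (leftTrees k r)
  rearrange : ∀ a b c e → a + (b + (c + e)) ≡ b + (a + c) + e
  rearrange = solve-∀

-- The number of left intervals of height suc k on trees of size n.
leftCount : ℕ → ℕ → ℕ
leftCount n k = length (pairs (leftTrees k) (trees n))

card-leftI : ∀ n k → HasCardinality (Among (λ t → size t ≡ n) (LeftI (suc k))) (leftCount n k)
card-leftI n k =
  let uniq , mem = pairs-enumerates (leftTrees k) (leftTrees-unique k) (trees-enumerates n)
  in card-cong (λ (s , t) → mk⇔ (λ (eq , i) → eq , ∈-leftTrees⁻ k s i) (λ (eq , l) → eq , ∈-leftTrees⁺ l))
       (pairs (leftTrees k) (trees n) , uniq , mem , refl)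

card-leftW : ∀ n k → HasCardinality (Among (DyckWord n) (LeftW (suc k))) (leftCount n k)
card-leftW n k =
  let uniq , mem = pairs-enumerates (leftWords k) (leftWords-unique k) (words-enumerates n)
  in card-cong (λ (v , w) → mk⇔ (λ (p , i) → p , ∈-leftWords⁻ k v i) (λ (p , l) → p , ∈-leftWords⁺ l))
       (pairs (leftWords k) (map code (trees n)) , uniq , mem ,
        length-pairs (leftTrees k) (leftWords k) code
          (λ t → trans (length-leftWords k t []) (ℕ.+-identityʳ _)) (trees n))

-- The right families are counted by symmetry.
card-rightI : ∀ n k → HasCardinality (Among (λ t → size t ≡ n) (RightI (suc k))) (leftCount n k)
card-rightI n k = card-cong
  (λ (s , t) → mk⇔
    (λ (eq , l) → let r = subst₂ (RightI (suc k)) (mirror-involutive s) (mirror-involutive t) (mirror-left l)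
                  in trans (size-≤ (proj₁ (rightI-sound r))) (trans (sym (size-mirror t)) eq) , r)
    (λ (eq , r) → trans (size-mirror t) (trans (sym (size-≤ (proj₁ (rightI-sound r)))) eq) , mirror-right r))
  (card-pullback (λ (s , t) → mirror t , mirror s)
    (λ eq → cong₂ _,_ (mirror-injective (cong proj₂ eq)) (mirror-injective (cong proj₁ eq)))
    (λ {(s , t)} _ → (mirror t , mirror s) , cong₂ _,_ (mirror-involutive s) (mirror-involutive t))
    (card-leftI n k))
  where
  mirror-injective : ∀ {s t} → mirror s ≡ mirror t → s ≡ t
  mirror-injective {s} {t} eq = trans (sym (mirror-involutive s)) (trans (cong mirror eq) (mirror-involutive t))

card-rightW : ∀ n k → HasCardinality (Among (DyckWord n) (RightW (suc k))) (leftCount n k)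
card-rightW n k = card-cong
  (λ (v , w) → mk⇔
    (λ (p , l) → subst (DyckWord n) (mirrorWord-involutive v) (mirrorWord-dyck p)
               , subst₂ (RightW (suc k)) (mirrorWord-involutive v) (mirrorWord-involutive w) (mirrorWord-leftW l))
    (λ (p , r) → mirrorWord-dyck p , mirrorWord-rightW r))
  (card-pullback (λ (v , w) → mirrorWord v , mirrorWord w)
    (λ eq → cong₂ _,_ (mirrorWord-injective (cong proj₁ eq)) (mirrorWord-injective (cong proj₂ eq)))
    (λ {(v , w)} _ → (mirrorWord v , mirrorWord w) , cong₂ _,_ (mirrorWord-involutive v) (mirrorWord-involutive w))
    (card-leftW n k))
  where
  mirrorWord-injective : ∀ {v w} → mirrorWord v ≡ mirrorWord w → v ≡ w
  mirrorWord-injective {v} {w} eq =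
    trans (sym (mirrorWord-involutive v)) (trans (cong mirrorWord eq) (mirrorWord-involutive w))

proj₁-embedding : ∀ {n} → ConvexEmbedding (_≤Tam_ {n}) _≤Tree_ proj₁
proj₁-embedding = record
  { mono    = λ le → le
  ; reflect = λ le → le
  ; convex  = λ {(_ , eq)} {_} {t} le _ → (t , trans (sym (size-≤ le)) eq) , refl
  }

theorem3p3 : ∀ (n k : ℕ) → n ≥ 1 →
    ∃ λ m → HasCardinality (LinearIntervalOfHeight (Tam-isPartialOrder n) k) m
    × HasCardinality (LinearIntervalOfHeight (Dyck-isPartialOrder n) k) m
theorem3p3 n k _ =
  intervalCount (length (trees n)) (leftCount n) k ,
  card-embedding (Tam-isPartialOrder n) ≤Tree-isPartialOrder proj₁-embedding
    proj₂ (λ {t} eq → (t , eq) , refl) (λ eq le → trans (sym (size-≤ le)) eq)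
    (card-linear tamari-classification (λ t → size t ≡ n)
      (enumerated (trees-enumerates n) refl) (card-leftI n) (card-rightI n) k) ,
  card-embedding (Dyck-isPartialOrder n) ⊑-isPartialOrder word-embedding
    word-dyck dyck-word dom-dyck
    (card-linear word-classification (DyckWord n)
      (enumerated (words-enumerates n) (length-map code (trees n))) (card-leftW n) (card-rightW n) k)
  where
  enumerated : ∀ {A : Set} {P : Pred A 0ℓ} {xs m} → Enumerates xs P → length xs ≡ m → HasCardinality P m
  enumerated (uniq , mem) len = _ , uniq , mem , len
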